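{- Let $m\ge 1$. The generating function $\sum_{n\ge 0}\big(\sum_{\pi\in NC_n}q^{\mu_{\tau}(\pi)}\big)x^n$ counting members of $NC_n$ for $n\ge 0$ according to the number of occurrences of the subword $\tau$ is given, for $\tau=1^m$, by $$\frac{1-qx+(q-1)x^m-\sqrt{(1-qx+(q-1)x^m)\big((1-4x)(1-qx)-3(q-1)x^m\big)}}{2x(1-qx+(q-1)x^{m-1})},$$ and, for $\tau=1^m2$, by $$\frac{1+(q-1)x^m-\sqrt{(1-(q-1)x^m)^2-4x}}{2x(1+(q-1)x^{m-1})}.$$
   Context: A set partition of $[n]=\{1,\dots,n\}$ with blocks $B_1,\dots,B_k$ ordered so that $\min B_1<\cdots<\min B_k$ is represented by its canonical sequential form $\pi=\pi_1\cdots\pi_n$, where $i\in B_{\pi_i}$ for each $i$. It is non-crossing if $\pi$ contains no (not necessarily consecutive) subsequence of the form $a\,b\,a\,b$ with $a<b$. $NC_n$ denotes the set of non-crossing partitions of $[n]$, identified with their canonical sequential forms ($NC_0$ consists of the empty partition). A subword pattern is a finite sequence $\tau=\tau_1\cdots\tau_k$ of positive integers whose set of distinct letters is $[\ell]$ for some $\ell$. An occurrence of $\tau$ in a sequence $\rho_1\cdots\rho_n$ is an index $i\in[n-k+1]$ such that the string of consecutive letters $\rho_i\cdots\rho_{i+k-1}$ is order-isomorphic to $\tau$ (same relative order, including equalities). $\mu_\tau(\pi)$ denotes the number of occurrences of $\tau$ in $\pi$. $1^m$ is the word of $m$ ones, and $1^m2$ is $m$ ones followed by a $2$. The formulas are identities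 of formal power series in $x$ (over $\mathbb{Q}(q)$), the square roots being those with constant term $1$. -}

module Defs where

open import Algebra.Bundles using (RawRing)
open import Data.Fin.Base as Fin using (Fin; toℕ)
import Data.Fin.Properties as Fin
open import Data.List.Base as List using (List; []; _∷_)
open import Data.List.Relation.Unary.All using (All; all?)
open import Data.Nat.Base as ℕ using (ℕ; zero; suc; _∸_; z≤n; s≤s)
import Data.Nat.Properties as ℕ
open import Data.Product.Base using (_×_; _,_; ∃-syntax)
open import Data.Rational.Base as ℚ using (ℚ; 0ℚ; 1ℚ; ≢-nonZero)
import Data.Rational.Properties as ℚ
open import Data.Sum.Base using (_⊎_; inj₁; inj₂; [_,_]′)
open import Data.Vec.Base as Vec using (Vec; []; _∷_; lookup)
open import Function.Base using (_∘_; _$_)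
open import Function.Bundles using (_⇔_; mk⇔; module Equivalence)
open import Function.Definitions using (StrictlySurjective)
open import Level using (Level; 0ℓ)
open import Relation.Binary.PropositionalEquality
  using (_≡_; _≢_; refl; sym; trans; cong; module ≡-Reasoning)
open import Relation.Nullary.Decidable.Core using (Dec; yes; no; map′; _×-dec_; _→-dec_; ¬?)
open import Relation.Nullary.Negation.Core using (¬_)

------------------------------------------------------------------------
-- Non-crossing partitions of [n]

-- A word  w : Vec (Fin k) n  describes k blocks of positions: position i
-- lies in block  lookup w i.  Positions and block labels are 0-based here;
-- `letters` restores the 1-based labels.

module _ {k n : ℕ} (w : Vec (Fin k) n) where

  BlocksNonempty : Set
  BlocksNonempty = StrictlySurjective _≡_ (lookup w)

  IsBlockMin : Fin n → Set
  IsBlockMin i = ∀ j → lookup w j ≡ lookup w i → i Fin.≤ j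

  -- min B₁ < min B₂ < ⋯ < min B_k
  MinimaIncreasing : Set
  MinimaIncreasing = ∀ i j → IsBlockMin i → IsBlockMin j →
    lookup w i Fin.< lookup w j → i Fin.< j

  IsCanonical : Set
  IsCanonical = BlocksNonempty × MinimaIncreasing

  -- a subsequence a b a b with a < b
  Crossing : Set
  Crossing = ∃[ i₁ ] ∃[ i₂ ] ∃[ i₃ ] ∃[ i₄ ]
    i₁ Fin.< i₂ × i₂ Fin.< i₃ × i₃ Fin.< i₄ ×
    lookup w i₁ ≡ lookup w i₃ × lookup w i₂ ≡ lookup w i₄ ×
    lookup w i₁ Fin.< lookup w i₂

  IsNonCrossingPartition : Set
  IsNonCrossingPartition = IsCanonical × ¬ Crossing

  isBlockMin? : ∀ i → Dec (IsBlockMin i)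
  isBlockMin? i = Fin.all? λ j → (lookup w j Fin.≟ lookup w i) →-dec (i Fin.≤? j)

  isCanonical? : Dec IsCanonical
  isCanonical? =
    (Fin.all? λ a → Fin.any? λ i → lookup w i Fin.≟ a) ×-dec
    (Fin.all? λ i → Fin.all? λ j → isBlockMin? i →-dec isBlockMin? j →-dec
      (lookup w i Fin.<? lookup w j) →-dec (i Fin.<? j))

  crossing? : Dec Crossing
  crossing? = Fin.any? λ i₁ → Fin.any? λ i₂ → Fin.any? λ i₃ → Fin.any? λ i₄ →
    (i₁ Fin.<? i₂) ×-dec (i₂ Fin.<? i₃) ×-dec (i₃ Fin.<? i₄) ×-dec
    (lookup w i₁ Fin.≟ lookup w i₃) ×-dec (lookup w i₂ Fin.≟ lookup w i₄) ×-dec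
    (lookup w i₁ Fin.<? lookup w i₂)

  isNonCrossingPartition? : Dec IsNonCrossingPartition
  isNonCrossingPartition? = isCanonical? ×-dec ¬? crossing?

  letters : List ℕ
  letters = List.map (suc ∘ toℕ) (Vec.toList w)

allWords : ∀ k n → List (Vec (Fin k) n)
allWords k zero    = [] ∷ []
allWords k (suc n) = List.cartesianProductWith _∷_ (List.allFin k) (allWords k n)

-- The canonical sequential forms of the members of NC_n, each listed once.
-- No form is lost by k ≤ n, since the k blocks are nonempty.
NC : ℕ → List (List ℕ)
NC n = List.concatMap
  (λ k → List.map letters (List.filter isNonCrossingPartition? (allWords k n)))
  (List.upTo (suc n))

------------------------------------------------------------------------
-- Subword patterns

SameOrder : ℕ × ℕ → ℕ × ℕ → Set
SameOrder (s , t) (s′ , t′) = (s ℕ.< s′ ⇔ t ℕ.< t′) × (s ≡ s′ ⇔ t ≡ t′)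

OrderIsomorphic : List ℕ → List ℕ → Set
OrderIsomorphic σ τ = List.length σ ≡ List.length τ ×
  All (λ p → All (SameOrder p) (List.zip σ τ)) (List.zip σ τ)

-- i is the 0-based starting index of the factor.
OccursAt : (τ ρ : List ℕ) → ℕ → Set
OccursAt τ ρ i = OrderIsomorphic (List.take (List.length τ) (List.drop i ρ)) τ

_⇔-dec_ : {A B : Set} → Dec A → Dec B → Dec (A ⇔ B)
a? ⇔-dec b? = map′ (λ (f , g) → mk⇔ f g) (λ e → Equivalence.to e , Equivalence.from e)
  ((a? →-dec b?) ×-dec (b? →-dec a?))

sameOrder? : ∀ p p′ → Dec (SameOrder p p′)
sameOrder? (s , t) (s′ , t′) =
  ((s ℕ.<? s′) ⇔-dec (t ℕ.<? t′)) ×-dec ((s ℕ.≟ s′) ⇔-dec (t ℕ.≟ t′))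

occursAt? : ∀ τ ρ i → Dec (OccursAt τ ρ i)
occursAt? τ ρ i = (_ ℕ.≟ _) ×-dec all? (λ p → all? (sameOrder? p) _) _

-- The number of occurrences among the n - k + 1 possible starting indices
-- (none if k > n), for k = |τ| and n = |ρ|.
μ : (τ ρ : List ℕ) → ℕ
μ τ ρ = List.length $ List.filter (occursAt? τ ρ) $
  List.upTo (suc (List.length ρ) ∸ List.length τ)

1^_ : ℕ → List ℕ
1^ m = List.replicate m 1

------------------------------------------------------------------------
-- The polynomial ring ℚ[q]

-- Coefficient lists, constant term first, trailing zeros allowed.
ℚ[q] : Set
ℚ[q] = List ℚ

module Polynomial where

  infix  4 _≈_
  infixl 7 _*_
  infixl 6 _+_
  infix  8 -_

  coeff : ℚ[q] → ℕ → ℚ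
  coeff []      i       = 0ℚ
  coeff (a ∷ p) zero    = a
  coeff (a ∷ p) (suc i) = coeff p i

  _≈_ : ℚ[q] → ℚ[q] → Set
  p ≈ r = ∀ i → coeff p i ≡ coeff r i

  _+_ : ℚ[q] → ℚ[q] → ℚ[q]
  []      + r       = r
  (a ∷ p) + []      = a ∷ p
  (a ∷ p) + (b ∷ r) = a ℚ.+ b ∷ p + r

  -_ : ℚ[q] → ℚ[q]
  -_ = List.map (ℚ.-_)

  scale : ℚ → ℚ[q] → ℚ[q]
  scale a = List.map (a ℚ.*_)

  _*_ : ℚ[q] → ℚ[q] → ℚ[q]
  []      * r = []
  (a ∷ p) * r = scale a r + (0ℚ ∷ p * r)

  0# 1# : ℚ[q]
  0# = []
  1# = 1ℚ ∷ []

  -- ℚ[q] has no zero divisors, so that fractions can be added and multiplied.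

  coeff-+ : ∀ p r i → coeff (p + r) i ≡ coeff p i ℚ.+ coeff r i
  coeff-+ []      r       i       = sym (ℚ.+-identityˡ (coeff r i))
  coeff-+ (a ∷ p) []      i       = sym (ℚ.+-identityʳ (coeff (a ∷ p) i))
  coeff-+ (a ∷ p) (b ∷ r) zero    = refl
  coeff-+ (a ∷ p) (b ∷ r) (suc i) = coeff-+ p r i

  coeff-scale : ∀ a r i → coeff (scale a r) i ≡ a ℚ.* coeff r i
  coeff-scale a []      i       = sym (ℚ.*-zeroʳ a)
  coeff-scale a (b ∷ r) zero    = refl
  coeff-scale a (b ∷ r) (suc i) = coeff-scale a r i

  coeff-∷-* : ∀ a p r i →
    coeff ((a ∷ p) * r) i ≡ a ℚ.* coeff r i ℚ.+ coeff (0ℚ ∷ p * r) i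
  coeff-∷-* a p r i =
    trans (coeff-+ (scale a r) _ i) (cong (ℚ._+ _) (coeff-scale a r i))

  a*0+0≡0 : ∀ a {b c} → b ≡ 0ℚ → c ≡ 0ℚ → a ℚ.* b ℚ.+ c ≡ 0ℚ
  a*0+0≡0 a refl refl = trans (ℚ.+-identityʳ _) (ℚ.*-zeroʳ a)

  -- If r vanishes up to degree n, so does every multiple of r.
  coeff-*-vanish : ∀ p r n → (∀ i → i ℕ.≤ n → coeff r i ≡ 0ℚ) → coeff (p * r) n ≡ 0ℚ
  coeff-*-vanish []      r n       r≡0 = refl
  coeff-*-vanish (a ∷ p) r zero    r≡0 =
    trans (coeff-∷-* a p r 0) (a*0+0≡0 a (r≡0 0 z≤n) refl)
  coeff-*-vanish (a ∷ p) r (suc n) r≡0 =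
    trans (coeff-∷-* a p r (suc n)) $ a*0+0≡0 a (r≡0 (suc n) ℕ.≤-refl) $
      coeff-*-vanish p r n λ i i≤n → r≡0 i (ℕ.m≤n⇒m≤1+n i≤n)

  a*b≡0⇒b≡0 : ∀ {a b} → a ≢ 0ℚ → a ℚ.* b ≡ 0ℚ → b ≡ 0ℚ
  a*b≡0⇒b≡0 {a} {b} a≢0 ab≡0 = begin
    b                      ≡⟨ ℚ.*-identityˡ b ⟨
    1ℚ ℚ.* b               ≡⟨ cong (ℚ._* b) (ℚ.*-inverseˡ a) ⟨
    ℚ.1/ a ℚ.* a ℚ.* b     ≡⟨ ℚ.*-assoc (ℚ.1/ a) a b ⟩
    ℚ.1/ a ℚ.* (a ℚ.* b)   ≡⟨ cong (ℚ.1/ a ℚ.*_) ab≡0 ⟩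
    ℚ.1/ a ℚ.* 0ℚ          ≡⟨ ℚ.*-zeroʳ (ℚ.1/ a) ⟩
    0ℚ                     ∎
    where
    open ≡-Reasoning
    instance _ = ≢-nonZero a≢0

  vanish-≤ : ∀ {a} → a ≢ 0ℚ → ∀ p r → (a ∷ p) * r ≈ 0# →
    ∀ n i → i ℕ.≤ n → coeff r i ≡ 0ℚ
  vanish-≤ {a} a≢0 p r pr≈0 = go
    where
    step : ∀ i → coeff (0ℚ ∷ p * r) i ≡ 0ℚ → coeff r i ≡ 0ℚ
    step i c≡0 = a*b≡0⇒b≡0 a≢0 $
      trans (sym (ℚ.+-identityʳ _)) $
      trans (cong (a ℚ.* coeff r i ℚ.+_) (sym c≡0)) $
      trans (sym (coeff-∷-* a p r i)) (pr≈0 i)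

    go : ∀ n i → i ℕ.≤ n → coeff r i ≡ 0ℚ
    go n       zero    _         = step zero refl
    go (suc n) (suc i) (s≤s i≤n) = step (suc i) $
      coeff-*-vanish p r i λ j j≤i → go n j (ℕ.≤-trans j≤i i≤n)

  noZeroDivisors : ∀ p r → p * r ≈ 0# → p ≈ 0# ⊎ r ≈ 0#
  noZeroDivisors []      r pr≈0 = inj₁ λ _ → refl
  noZeroDivisors (a ∷ p) r pr≈0 with a ℚ.≟ 0ℚ
  ... | no a≢0   = inj₂ λ i → vanish-≤ a≢0 p r pr≈0 i i ℕ.≤-refl
  ... | yes refl = [ inj₁ ∘ shift , inj₂ ]′ (noZeroDivisors p r p′r≈0)
    where
    shift : p ≈ 0# → (0ℚ ∷ p) ≈ 0#
    shift p≈0 zero    = refl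
    shift p≈0 (suc i) = p≈0 i

    p′r≈0 : p * r ≈ 0#
    p′r≈0 i = begin
      coeff (p * r) i                                       ≡⟨ ℚ.+-identityˡ _ ⟨
      0ℚ ℚ.+ coeff (p * r) i                                ≡⟨ cong (ℚ._+ coeff (p * r) i) (ℚ.*-zeroˡ (coeff r (suc i))) ⟨
      0ℚ ℚ.* coeff r (suc i) ℚ.+ coeff (0ℚ ∷ p * r) (suc i) ≡⟨ coeff-∷-* 0ℚ p r (suc i) ⟨
      coeff ((0ℚ ∷ p) * r) (suc i)                          ≡⟨ pr≈0 (suc i) ⟩
      0ℚ                                                    ∎
      where open ≡-Reasoning

  *-nonZero : ∀ p r → ¬ p ≈ 0# → ¬ r ≈ 0# → ¬ p * r ≈ 0#
  *-nonZero p r p≉0 r≉0 pr≈0 = [ p≉0 , r≉0 ]′ (noZeroDivisors p r pr≈0)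

  1≉0 : ¬ 1# ≈ 0#
  1≉0 1≈0 with () ← 1≈0 0

------------------------------------------------------------------------
-- The field ℚ(q) of fractions of ℚ[q]

module P = Polynomial

record ℚ⟨q⟩ : Set where
  constructor fraction
  field
    num   : ℚ[q]
    den   : ℚ[q]
    den≉0 : ¬ den P.≈ P.0#

module Fraction where
  open ℚ⟨q⟩

  polynomial : ℚ[q] → ℚ⟨q⟩
  polynomial p = fraction p P.1# P.1≉0

  rawRing : RawRing 0ℓ 0ℓ
  rawRing = record
    { Carrier = ℚ⟨q⟩
    ; _≈_     = λ f g → num f P.* den g P.≈ num g P.* den f
    ; _+_     = λ f g → fraction (num f P.* den g P.+ num g P.* den f)
                                 (den f P.* den g) (P.*-nonZero (den f) (den g) (den≉0 f) (den≉0 g))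
    ; _*_     = λ f g → fraction (num f P.* num g)
                                 (den f P.* den g) (P.*-nonZero (den f) (den g) (den≉0 f) (den≉0 g))
    ; -_      = λ f → fraction (P.- num f) (den f) (den≉0 f)
    ; 0#      = polynomial P.0#
    ; 1#      = polynomial P.1#
    }

  open RawRing rawRing
  open import Algebra.Definitions.RawSemiring rawSemiring using (_^_)

  q : ℚ⟨q⟩
  q = polynomial (0ℚ ∷ 1ℚ ∷ [])

  -- ∑_{π ∈ NCₙ} q^(μ τ π)
  distribution : List ℕ → ℕ → ℚ⟨q⟩
  distribution τ n = List.foldr _+_ 0# (List.map (λ π → q ^ μ τ π) (NC n))

------------------------------------------------------------------------
-- Formal power series in x

module PowerSeries {c ℓ : Level} (R : RawRing c ℓ) where
  private module R = RawRing R
  open import Algebra.Definitions.RawSemiring R.rawSemiring using (sum)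

  Series : Set c
  Series = ℕ → R.Carrier

  const : R.Carrier → Series
  const a zero    = a
  const a (suc _) = R.0#

  x : Series
  x zero          = R.0#
  x (suc zero)    = R.1#
  x (suc (suc _)) = R.0#

  rawRing : RawRing c ℓ
  rawRing = record
    { Carrier = Series
    ; _≈_     = λ f g → ∀ n → f n R.≈ g n
    ; _+_     = λ f g n → f n R.+ g n
    ; _*_     = λ f g n → sum {suc n} λ i → f (toℕ i) R.* g (n ∸ toℕ i)
    ; -_      = λ f n → R.- f n
    ; 0#      = const R.0#
    ; 1#      = const R.1#
    }

  open RawRing rawRing

  infix 4 _IsSqrtOf_ _IsQuotientOf_By_

  -- The square root with constant term 1.
  _IsSqrtOf_ : Series → Series → Set ℓ
  s IsSqrtOf d = s * s ≈ d × s 0 R.≈ R.1#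

  -- f = a / b in the field of fractions; b need not be invertible as a series.
  _IsQuotientOf_By_ : Series → Series → Series → Set ℓ
  f IsQuotientOf a By b = b ≉ 0# × b * f ≈ a

------------------------------------------------------------------------
-- The ring ℚ(q)[[x]]

module ℚ⟨q⟩⟦x⟧ where
  open PowerSeries Fraction.rawRing public
  open RawRing rawRing public
  open import Algebra.Definitions.RawSemiring rawSemiring public
    using (_^_) renaming (_×_ to _·_)

  infixl 6 _-_
  _-_ : Series → Series → Series
  f - g = f + (- g)

  q : Series
  q = const Fraction.q

  genFun : List ℕ → Series
  genFun = Fraction.distribution

{-# OPTIONS --safe #-}

-- Reading a non-crossing partition from left to right, only a stack of blocks can
-- still be continued: the next letter opens a new block, repeats the top block, or
-- returns to a lower block and closes all those above it.  The occurrences of both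
-- patterns are determined by the length of each run and by whether a larger letter
-- follows it.  Cutting a walk when it leaves the bottom block shows that d + 1 open
-- blocks contribute F^d times what one contributes, where F is the generating
-- function sought.  With T_r the generating function of the continuations of a run
-- of length r, this gives F = 1 + x T₁ and T_r = e_r + x (T_{r+1} + u_r T₁ F).  For
-- r < m we have e_r = u_r = 1, and from r = m on the T_r form a geometric sequence,
-- so eliminating them leaves a quadratic equation for F.  The square root in the
-- closed form (A − s) / D is then s = A − D F.

module Submission where

open import Algebra.Bundles using (CommutativeRing; RawRing)
open import Algebra.Morphism.Structures using (IsRingMonomorphism)
import Algebra.Morphism.RingMonomorphism as RingMonomorphism
import Algebra.Properties.Ring as RingProperties
import Algebra.Properties.Semiring.Mult.TCOptimised as Mult
import Algebra.Solver.Ring as RingSolver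
open import Algebra.Solver.Ring.AlmostCommutativeRing
  using (fromCommutativeRing; _-Raw-AlmostCommutative⟶_)
open import Algebra.Structures using (IsCommutativeRing)
open import Data.Bool.Base using (true; false)
open import Data.Fin.Base as Fin using (Fin; zero; suc; toℕ; fromℕ<)
import Data.Fin.Properties as Fin
import Data.Integer.Base as ℤ
import Data.Integer.Properties as ℤ
open import Data.List.Base as List
  using (List; []; _∷_; _++_; [_]; map; foldr; length; filter; upTo; applyUpTo; replicate; take; zip)
open import Data.List.Membership.Propositional using (_∈_; find; lose)
import Data.List.Membership.Propositional.Properties as ∈
open import Data.List.Membership.Propositional.Properties.WithK using (unique∧set⇒bag)
open import Data.List.Properties using (∷-injective; filter-accept; filter-reject; length-take)
open import Data.List.Relation.Binary.BagAndSetEquality using (∼bag⇒↭)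
open import Data.List.Relation.Binary.Disjoint.Propositional using (Disjoint)
open import Data.List.Relation.Binary.Permutation.Propositional as ↭ using (_↭_)
open import Data.List.Relation.Unary.All as All using (All; []; _∷_)
import Data.List.Relation.Unary.All.Properties as All
open import Data.List.Relation.Unary.AllPairs as AllPairs using (AllPairs; []; _∷_)
import Data.List.Relation.Unary.AllPairs.Properties as AllPairs
open import Data.List.Relation.Unary.Any using (here; there)
open import Data.List.Relation.Unary.Unique.Propositional using (Unique)
import Data.List.Relation.Unary.Unique.Propositional.Properties as Unique
open import Data.Maybe.Base using (Maybe; just; nothing)
open import Data.Nat.Base as ℕ
  using (ℕ; zero; suc; _∸_; _⊓_; _≤_; _<_; _>_; z≤n; s≤s; z<s; s<s)
import Data.Nat.Properties as ℕ
open import Data.Product.Base using (_×_; _,_; ∃-syntax; proj₁; proj₂)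
open import Data.Rational.Base as ℚ using (ℚ)
import Data.Rational.Properties as ℚ
open import Data.Sum.Base using (_⊎_; inj₁; inj₂)
open import Data.Vec.Base using (Vec; []; _∷_; lookup)
open import Function.Base using (_∘_; _$_; id; case_of_)
open import Function.Bundles using (mk⇔; module Equivalence)
open import Level using (0ℓ; _⊔_)
open import Relation.Binary.Definitions using (tri<; tri≈; tri>)
open import Relation.Binary.PropositionalEquality as ≡ using (_≡_; _≢_)
import Relation.Binary.Reasoning.Setoid as ≈-Reasoning
open import Relation.Nullary using (¬_; yes; no; does; contradiction)
open import Relation.Nullary.Decidable using (¬?; decidable-stable)
open import Relation.Unary using (Decidable)
open import Defs

-- The statement is phrased with bare operations, so ring laws for `ℚ[q]`, ℚ(q) and ℚ(q)[[x]] are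
-- established first; counting and elimination then run over an arbitrary commutative ring with a
-- marked element. The product T₁ F in the recursion comes from opening a second block, and x T₁ = F
-- - 1 makes it quadratic in F. The run length r is unbounded; the infinite system closes because
-- beyond m a longer run only multiplies the weights by a fixed ratio, which is q for 1^m and 1 for
-- 1^m 2. The denominator D = 2xB has constant term 0, so the quotient is the equation D F = A - s.
-- With s defined from F this holds by construction. The content lies in s², obtained by completing
-- the square in the quadratic equation, in the constant term of s, and in D ≠ 0.

-- Polynomial identities with integer coefficients in a commutative ring

module IntegerSolver {c ℓ} (R : CommutativeRing c ℓ) where
  open CommutativeRing R
  open RingProperties ring
  open Mult semiring using (×-homo-+; ×1-homo-*; 1+×) renaming (_×_ to _·_)
  open ≈-Reasoning setoid

  -- The canonical homomorphism from the integers. With this form of multiples `1 · 1#` reduces to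
  -- `1#`, so the solver constants `:0` and `:1` denote `0#` and `1#` themselves.
  ⟦_⟧ℤ : ℤ.ℤ → Carrier
  ⟦ ℤ.+ n ⟧ℤ      = n · 1#
  ⟦ ℤ.-[1+ n ] ⟧ℤ = - (suc n · 1#)

  neg-homo : ∀ i → ⟦ ℤ.- i ⟧ℤ ≈ - ⟦ i ⟧ℤ
  neg-homo (ℤ.+ zero)  = sym -0#≈0#
  neg-homo (ℤ.+ suc n) = refl
  neg-homo ℤ.-[1+ n ]  = sym (-‿involutive _)

  ⊖-homo : ∀ m n → ⟦ m ℤ.⊖ n ⟧ℤ ≈ m · 1# - n · 1#
  ⊖-homo m       zero    = sym (trans (+-congˡ -0#≈0#) (+-identityʳ _))
  ⊖-homo zero    (suc n) = sym (+-identityˡ _)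
  ⊖-homo (suc m) (suc n) = begin
    ⟦ suc m ℤ.⊖ suc n ⟧ℤ                ≡⟨ ≡.cong ⟦_⟧ℤ (ℤ.[1+m]⊖[1+n]≡m⊖n m n) ⟩
    ⟦ m ℤ.⊖ n ⟧ℤ                        ≈⟨ ⊖-homo m n ⟩
    m · 1# - n · 1#                     ≈⟨ +-congʳ (+-identityʳ _) ⟨
    m · 1# + 0# - n · 1#                ≈⟨ +-congʳ (+-congˡ (-‿inverseʳ 1#)) ⟨
    m · 1# + (1# - 1#) - n · 1#         ≈⟨ +-congʳ (+-assoc _ _ _) ⟨
    m · 1# + 1# - 1# - n · 1#           ≈⟨ +-assoc _ _ _ ⟩
    m · 1# + 1# + (- 1# - n · 1#)       ≈⟨ +-cong (trans (+-comm _ _) (sym (1+× m 1#))) (trans (-‿+-comm _ _) (-‿cong (sym (1+× n 1#)))) ⟩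
    suc m · 1# - suc n · 1#             ∎

  +-homo : ∀ i j → ⟦ i ℤ.+ j ⟧ℤ ≈ ⟦ i ⟧ℤ + ⟦ j ⟧ℤ
  +-homo (ℤ.+ m)    (ℤ.+ n)    = ×-homo-+ 1# m n
  +-homo (ℤ.+ m)    ℤ.-[1+ n ] = ⊖-homo m (suc n)
  +-homo ℤ.-[1+ m ] (ℤ.+ n)    = trans (⊖-homo n (suc m)) (+-comm _ _)
  +-homo ℤ.-[1+ m ] ℤ.-[1+ n ] = begin
    - (suc (suc (m ℕ.+ n)) · 1#)          ≡⟨ ≡.cong (λ k → - (k · 1#)) (≡.cong suc (ℕ.+-suc m n)) ⟨
    - ((suc m ℕ.+ suc n) · 1#)            ≈⟨ -‿cong (×-homo-+ 1# (suc m) (suc n)) ⟩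
    - (suc m · 1# + suc n · 1#)           ≈⟨ -‿+-comm _ _ ⟨
    - (suc m · 1#) - suc n · 1#           ∎

  pos*-homo : ∀ m j → ⟦ ℤ.+ m ℤ.* j ⟧ℤ ≈ m · 1# * ⟦ j ⟧ℤ
  pos*-homo m (ℤ.+ n)    = trans (reflexive (≡.cong ⟦_⟧ℤ (≡.sym (ℤ.pos-* m n)))) (×1-homo-* m n)
  pos*-homo m ℤ.-[1+ n ] = begin
    ⟦ ℤ.+ m ℤ.* ℤ.-[1+ n ] ⟧ℤ         ≡⟨ ≡.cong ⟦_⟧ℤ (ℤ.neg-distribʳ-* (ℤ.+ m) (ℤ.+ suc n)) ⟨
    ⟦ ℤ.- (ℤ.+ m ℤ.* ℤ.+ suc n) ⟧ℤ    ≈⟨ neg-homo (ℤ.+ m ℤ.* ℤ.+ suc n) ⟩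
    - ⟦ ℤ.+ m ℤ.* ℤ.+ suc n ⟧ℤ        ≈⟨ -‿cong (pos*-homo m (ℤ.+ suc n)) ⟩
    - (m · 1# * suc n · 1#)           ≈⟨ -‿distribʳ-* _ _ ⟩
    m · 1# * - (suc n · 1#)           ∎

  *-homo : ∀ i j → ⟦ i ℤ.* j ⟧ℤ ≈ ⟦ i ⟧ℤ * ⟦ j ⟧ℤ
  *-homo (ℤ.+ m)    j = pos*-homo m j
  *-homo ℤ.-[1+ m ] j = begin
    ⟦ ℤ.-[1+ m ] ℤ.* j ⟧ℤ             ≡⟨ ≡.cong ⟦_⟧ℤ (ℤ.neg-distribˡ-* (ℤ.+ suc m) j) ⟨
    ⟦ ℤ.- (ℤ.+ suc m ℤ.* j) ⟧ℤ        ≈⟨ neg-homo (ℤ.+ suc m ℤ.* j) ⟩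
    - ⟦ ℤ.+ suc m ℤ.* j ⟧ℤ            ≈⟨ -‿cong (pos*-homo (suc m) j) ⟩
    - (suc m · 1# * ⟦ j ⟧ℤ)           ≈⟨ -‿distribˡ-* _ _ ⟩
    - (suc m · 1#) * ⟦ j ⟧ℤ           ∎

  morphism : ℤ.+-*-rawRing -Raw-AlmostCommutative⟶ fromCommutativeRing R
  morphism = record
    { ⟦_⟧    = ⟦_⟧ℤ
    ; +-homo = +-homo
    ; *-homo = *-homo
    ; -‿homo = neg-homo
    ; 0-homo = refl
    ; 1-homo = refl
    }

  _≟ℤ_ : ∀ i j → Maybe (⟦ i ⟧ℤ ≈ ⟦ j ⟧ℤ)
  i ≟ℤ j with i ℤ.≟ j
  ... | yes i≡j = just (reflexive (≡.cong ⟦_⟧ℤ i≡j))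
  ... | no  _   = nothing

  open RingSolver ℤ.+-*-rawRing (fromCommutativeRing R) morphism _≟ℤ_ public
    using (solve; _:=_; _:+_; _:*_; _:-_; :-_; con; Polynomial)

  :0 :1 : ∀ {n} → Polynomial n
  :0 = con ℤ.0ℤ
  :1 = con ℤ.1ℤ

-- The commutative ring of formal power series

module SeriesRing {c ℓ} (R : CommutativeRing c ℓ) where
  private module R = CommutativeRing R
  open PowerSeries R.rawRing
  open RawRing rawRing
  open IntegerSolver R
  open ≈-Reasoning R.setoid

  -- Drives the inductions on products: `(f * g) (suc n)` unfolds to `f 0 * g (suc n)` plus
  -- `(tail f * g) n`, so the index decreases while the left factor varies.
  tail : Series → Series
  tail f n = f (suc n)

  *-cong : ∀ {f f′ g g′} → f ≈ f′ → g ≈ g′ → f * g ≈ f′ * g′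
  *-cong f≈ g≈ zero    = R.+-congʳ (R.*-cong (f≈ 0) (g≈ 0))
  *-cong f≈ g≈ (suc n) =
    R.+-cong (R.*-cong (f≈ 0) (g≈ (suc n))) (*-cong (f≈ ∘ suc) g≈ n)

  *-zeroˡ : ∀ {f} g → (∀ n → f n R.≈ R.0#) → ∀ n → (f * g) n R.≈ R.0#
  *-zeroˡ {f} g f≈0 zero    = begin
    f 0 R.* g 0 R.+ R.0#      ≈⟨ R.+-congʳ (R.*-congʳ (f≈0 0)) ⟩
    R.0# R.* g 0 R.+ R.0#     ≈⟨ solve 1 (λ a → :0 :* a :+ :0 := :0) R.refl _ ⟩
    R.0#                      ∎
  *-zeroˡ {f} g f≈0 (suc n) = begin
    f 0 R.* g (suc n) R.+ (tail f * g) n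
      ≈⟨ R.+-cong (R.*-congʳ (f≈0 0)) (*-zeroˡ g (f≈0 ∘ suc) n) ⟩
    R.0# R.* g (suc n) R.+ R.0#
      ≈⟨ solve 1 (λ a → :0 :* a :+ :0 := :0) R.refl _ ⟩
    R.0# ∎

  *-identityˡ : ∀ f → 1# * f ≈ f
  *-identityˡ f zero    = solve 1 (λ a → :1 :* a :+ :0 := a) R.refl _
  *-identityˡ f (suc n) = begin
    R.1# R.* f (suc n) R.+ (tail 1# * f) n ≈⟨ R.+-congˡ (*-zeroˡ f (λ _ → R.refl) n) ⟩
    R.1# R.* f (suc n) R.+ R.0#            ≈⟨ solve 1 (λ a → :1 :* a :+ :0 := a) R.refl _ ⟩
    f (suc n)                              ∎

  *-distribʳ-+ : ∀ h f g → (f + g) * h ≈ f * h + g * h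
  *-distribʳ-+ h f g zero    =
    solve 3 (λ a b c → (a :+ b) :* c :+ :0 := (a :* c :+ :0) :+ (b :* c :+ :0)) R.refl _ _ _
  *-distribʳ-+ h f g (suc n) = begin
    (f 0 R.+ g 0) R.* h (suc n) R.+ ((tail f + tail g) * h) n
      ≈⟨ R.+-congˡ (*-distribʳ-+ h (tail f) (tail g) n) ⟩
    (f 0 R.+ g 0) R.* h (suc n) R.+ ((tail f * h) n R.+ (tail g * h) n)
      ≈⟨ solve 5 (λ a b c d e → (a :+ b) :* c :+ (d :+ e) := (a :* c :+ d) :+ (b :* c :+ e)) R.refl _ _ _ _ _ ⟩
    (f * h) (suc n) R.+ (g * h) (suc n) ∎

  *-scaleˡ : ∀ a f g n → ((λ i → a R.* f i) * g) n R.≈ a R.* (f * g) n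
  *-scaleˡ a f g zero    =
    solve 3 (λ a b c → (a :* b) :* c :+ :0 := a :* (b :* c :+ :0)) R.refl _ _ _
  *-scaleˡ a f g (suc n) = begin
    a R.* f 0 R.* g (suc n) R.+ ((λ i → a R.* tail f i) * g) n
      ≈⟨ R.+-congˡ (*-scaleˡ a (tail f) g n) ⟩
    a R.* f 0 R.* g (suc n) R.+ a R.* (tail f * g) n
      ≈⟨ solve 4 (λ a b c d → a :* b :* c :+ a :* d := a :* (b :* c :+ d)) R.refl _ _ _ _ ⟩
    a R.* (f * g) (suc n) ∎

  -- The convolution unfolds by its first term. Splitting off the last term instead gives the mirror
  -- image that commutativity has to compare with.
  *-suc : ∀ f g n → (f * g) (suc n) R.≈ (f * tail g) n R.+ f (suc n) R.* g 0
  *-suc f g zero    =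
    solve 4 (λ a b c d → a :* b :+ (c :* d :+ :0) := (a :* b :+ :0) :+ c :* d) R.refl _ _ _ _
  *-suc f g (suc n) = begin
    f 0 R.* g (suc (suc n)) R.+ (tail f * g) (suc n)
      ≈⟨ R.+-congˡ (*-suc (tail f) g n) ⟩
    f 0 R.* g (suc (suc n)) R.+ ((tail f * tail g) n R.+ f (suc (suc n)) R.* g 0)
      ≈⟨ R.+-assoc _ _ _ ⟨
    (f * tail g) (suc n) R.+ f (suc (suc n)) R.* g 0 ∎

  *-comm : ∀ f g → f * g ≈ g * f
  *-comm f g zero    = R.+-congʳ (R.*-comm _ _)
  *-comm f g (suc n) = begin
    f 0 R.* g (suc n) R.+ (tail f * g) n   ≈⟨ R.+-cong (R.*-comm _ _) (*-comm (tail f) g n) ⟩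
    g (suc n) R.* f 0 R.+ (g * tail f) n   ≈⟨ R.+-comm _ _ ⟩
    (g * tail f) n R.+ g (suc n) R.* f 0   ≈⟨ *-suc g f n ⟨
    (g * f) (suc n)                        ∎

  *-assoc : ∀ f g h → (f * g) * h ≈ f * (g * h)
  *-assoc f g h zero    =
    solve 3 (λ a b c → (a :* b :+ :0) :* c :+ :0 := a :* (b :* c :+ :0) :+ :0) R.refl _ _ _
  *-assoc f g h (suc n) = begin
    (f 0 R.* g 0 R.+ R.0#) R.* h (suc n) R.+ (((λ i → f 0 R.* tail g i) + tail f * g) * h) n
      ≈⟨ R.+-congˡ (*-distribʳ-+ h (λ i → f 0 R.* tail g i) (tail f * g) n) ⟩
    (f 0 R.* g 0 R.+ R.0#) R.* h (suc n) R.+ (((λ i → f 0 R.* tail g i) * h) n R.+ ((tail f * g) * h) n)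
      ≈⟨ R.+-congˡ (R.+-cong (*-scaleˡ (f 0) (tail g) h n) (*-assoc (tail f) g h n)) ⟩
    (f 0 R.* g 0 R.+ R.0#) R.* h (suc n) R.+ (f 0 R.* (tail g * h) n R.+ (tail f * (g * h)) n)
      ≈⟨ solve 5 (λ a b c d e → (a :* b :+ :0) :* c :+ (a :* d :+ e) := a :* (b :* c :+ d) :+ e) R.refl _ _ _ _ _ ⟩
    f 0 R.* (g 0 R.* h (suc n) R.+ (tail g * h) n) R.+ (tail f * (g * h)) n ∎

  x*f-suc : ∀ f n → (x * f) (suc n) R.≈ f n
  x*f-suc f n = begin
    R.0# R.* f (suc n) R.+ (tail x * f) n ≈⟨ R.+-congˡ (*-cong {g = f} tail-x (λ _ → R.refl) n) ⟩
    R.0# R.* f (suc n) R.+ (1# * f) n     ≈⟨ R.+-congˡ (*-identityˡ f n) ⟩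
    R.0# R.* f (suc n) R.+ f n            ≈⟨ solve 2 (λ a b → :0 :* a :+ b := b) R.refl _ _ ⟩
    f n                                   ∎
    where
    tail-x : tail x ≈ 1#
    tail-x zero    = R.refl
    tail-x (suc _) = R.refl

  x*f-zero : ∀ f → (x * f) 0 R.≈ R.0#
  x*f-zero f = solve 1 (λ a → :0 :* a :+ :0 := :0) R.refl _

  const-* : ∀ a f n → (const a * f) n R.≈ a R.* f n
  const-* a f zero    = R.+-identityʳ _
  const-* a f (suc n) =
    R.trans (R.+-congˡ (*-zeroˡ f (λ _ → R.refl) n)) (R.+-identityʳ _)

  0≈ : ∀ n → 0# n R.≈ R.0#
  0≈ zero    = R.refl
  0≈ (suc n) = R.refl

  +-identityˡ : ∀ f → 0# + f ≈ f
  +-identityˡ f n = R.trans (R.+-congʳ (0≈ n)) (R.+-identityˡ _)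

  -‿inverseˡ : ∀ f → (- f) + f ≈ 0#
  -‿inverseˡ f n = R.trans (R.-‿inverseˡ _) (R.sym (0≈ n))

  isCommutativeRing : IsCommutativeRing _≈_ _+_ _*_ -_ 0# 1#
  isCommutativeRing = record
    { isRing = record
      { +-isAbelianGroup = record
        { isGroup = record
          { isMonoid = record
            { isSemigroup = record
              { isMagma = record
                { isEquivalence = record
                  { refl  = λ _ → R.refl
                  ; sym   = λ f≈g n → R.sym (f≈g n)
                  ; trans = λ f≈g g≈h n → R.trans (f≈g n) (g≈h n)
                  }
                ; ∙-cong = λ f≈ g≈ n → R.+-cong (f≈ n) (g≈ n)
                }
              ; assoc = λ _ _ _ _ → R.+-assoc _ _ _
              }
            ; identity = +-identityˡ , λ f n → R.trans (R.+-comm _ _) (+-identityˡ f n)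
            }
          ; inverse = -‿inverseˡ , λ f n → R.trans (R.+-comm _ _) (-‿inverseˡ f n)
          ; ⁻¹-cong = λ f≈ n → R.-‿cong (f≈ n)
          }
        ; comm = λ _ _ _ → R.+-comm _ _
        }
      ; *-cong     = *-cong
      ; *-assoc    = *-assoc
      ; *-identity = *-identityˡ , λ f n → R.trans (*-comm f 1# n) (*-identityˡ f n)
      ; distrib    =
          (λ f g h n → R.trans (*-comm f (g + h) n) $ R.trans (*-distribʳ-+ f g h n) $
            R.+-cong (*-comm g f n) (*-comm h f n))
        , *-distribʳ-+
      }
    ; *-comm = *-comm
    }

  commutativeRing : CommutativeRing c ℓ
  commutativeRing = record { isCommutativeRing = isCommutativeRing }

-- Ring laws for ℚ[q] and its field of fractions

module PolynomialRing where
  module ℚ⟦q⟧ = SeriesRing ℚ.+-*-commutativeRing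
  module S = CommutativeRing ℚ⟦q⟧.commutativeRing

  rawRing : RawRing 0ℓ 0ℓ
  rawRing = record
    { Carrier = ℚ[q] ; _≈_ = P._≈_ ; _+_ = P._+_ ; _*_ = P._*_ ; -_ = P.-_ ; 0# = P.0# ; 1# = P.1# }

  coeff-* : ∀ p r → P.coeff (p P.* r) S.≈ P.coeff p S.* P.coeff r
  coeff-* []      r n       = ≡.sym (ℚ⟦q⟧.*-zeroˡ (P.coeff r) (λ _ → ≡.refl) n)
  coeff-* (a ∷ p) r zero    = P.coeff-∷-* a p r 0
  coeff-* (a ∷ p) r (suc n) =
    ≡.trans (P.coeff-∷-* a p r (suc n)) (≡.cong (a ℚ.* P.coeff r (suc n) ℚ.+_) (coeff-* p r n))

  coeff-neg : ∀ p n → P.coeff (P.- p) n ≡ ℚ.- P.coeff p n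
  coeff-neg []      n       = ≡.refl
  coeff-neg (a ∷ p) zero    = ≡.refl
  coeff-neg (a ∷ p) (suc n) = coeff-neg p n

  -- Equality of coefficient lists is by definition equality of their images in ℚ[[q]], so the ring
  -- laws there can be pulled back.
  coeff-isRingMonomorphism : IsRingMonomorphism rawRing S.rawRing P.coeff
  coeff-isRingMonomorphism = record
    { isRingHomomorphism = record
      { isSemiringHomomorphism = record
        { isNearSemiringHomomorphism = record
          { +-isMonoidHomomorphism = record
            { isMagmaHomomorphism = record
              { isRelHomomorphism = record { cong = λ p≈r → p≈r }
              ; homo = P.coeff-+
              }
            ; ε-homo = λ n → ≡.sym (ℚ⟦q⟧.0≈ n)
            }
          ; *-homo = coeff-*
          }
        ; 1#-homo = λ { zero → ≡.refl ; (suc _) → ≡.refl }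
        }
      ; -‿homo = coeff-neg
      }
    ; injective = λ p≈r → p≈r
    }

  commutativeRing : CommutativeRing 0ℓ 0ℓ
  commutativeRing = record
    { isCommutativeRing =
        RingMonomorphism.isCommutativeRing coeff-isRingMonomorphism S.isCommutativeRing
    }

module Localisation {c ℓ} (R : CommutativeRing c ℓ) where
  open CommutativeRing R hiding (rawRing; isCommutativeRing)
  open IntegerSolver R
  open ≈-Reasoning setoid

  module Quotients {p} (Denominator : Carrier → Set p)
    (*-closed : ∀ a b → Denominator a → Denominator b → Denominator (a * b))
    (1-closed : Denominator 1#)
    (*-cancelˡ : ∀ {a b c} → Denominator a → a * b ≈ a * c → b ≈ c)
    where

    record Quotient : Set (c ⊔ p) where
      constructor quotient
      field
        num   : Carrier
        den   : Carrier
        valid : Denominator den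
    open Quotient

    rawRing : RawRing (c ⊔ p) ℓ
    rawRing = record
      { Carrier = Quotient
      ; _≈_     = λ f g → num f * den g ≈ num g * den f
      ; _+_     = λ f g → quotient (num f * den g + num g * den f)
                                   (den f * den g) (*-closed (den f) (den g) (valid f) (valid g))
      ; _*_     = λ f g → quotient (num f * num g)
                                   (den f * den g) (*-closed (den f) (den g) (valid f) (valid g))
      ; -_      = λ f → quotient (- num f) (den f) (valid f)
      ; 0#      = quotient 0# 1# 1-closed
      ; 1#      = quotient 1# 1# 1-closed
      }
    private module Q = RawRing rawRing

    -- This is where denominators have to be cancelled. The other laws are polynomial identities in
    -- numerators and denominators, or follow from the given cross-multiplied equations.
    ≈-trans : ∀ {f g h} → f Q.≈ g → g Q.≈ h → f Q.≈ h
    ≈-trans {quotient a b _} {quotient c d d∈} {quotient e f _} ad≈cb cf≈ed =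
      *-cancelˡ d∈ (begin
        d * (a * f)   ≈⟨ solve 3 (λ d a f → d :* (a :* f) := (a :* d) :* f) refl d a f ⟩
        (a * d) * f   ≈⟨ *-congʳ ad≈cb ⟩
        (c * b) * f   ≈⟨ solve 3 (λ c b f → (c :* b) :* f := (c :* f) :* b) refl c b f ⟩
        (c * f) * b   ≈⟨ *-congʳ cf≈ed ⟩
        (e * d) * b   ≈⟨ solve 3 (λ e d b → (e :* d) :* b := d :* (e :* b)) refl e d b ⟩
        d * (e * b)   ∎)

    isCommutativeRing : IsCommutativeRing Q._≈_ Q._+_ Q._*_ Q.-_ Q.0# Q.1#
    isCommutativeRing = record
      { isRing = record
        { +-isAbelianGroup = record
          { isGroup = record
            { isMonoid = record
              { isSemigroup = record
                { isMagma = record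
                  { isEquivalence = record { refl = refl ; sym = sym ; trans = λ {f} {g} {h} → ≈-trans {f} {g} {h} }
                  ; ∙-cong = λ {f} {f′} {g} {g′} f≈ g≈ →
                      let quotient a b _ = f; quotient a′ b′ _ = f′
                          quotient c d _ = g; quotient c′ d′ _ = g′ in begin
                      (a * d + c * b) * (b′ * d′)
                        ≈⟨ solve 6 (λ a b c d b′ d′ → (a :* d :+ c :* b) :* (b′ :* d′) :=
                             (a :* b′) :* (d :* d′) :+ (c :* d′) :* (b :* b′)) refl a b c d b′ d′ ⟩
                      (a * b′) * (d * d′) + (c * d′) * (b * b′)
                        ≈⟨ +-cong (*-congʳ f≈) (*-congʳ g≈) ⟩
                      (a′ * b) * (d * d′) + (c′ * d) * (b * b′)
                        ≈⟨ solve 6 (λ a′ b c′ d b′ d′ → (a′ :* b) :* (d :* d′) :+ (c′ :* d) :* (b :* b′) :=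
                             (a′ :* d′ :+ c′ :* b′) :* (b :* d)) refl a′ b c′ d b′ d′ ⟩
                      (a′ * d′ + c′ * b′) * (b * d) ∎
                  }
                ; assoc = λ (quotient a b _) (quotient c d _) (quotient e f _) →
                    solve 6 (λ a b c d e f →
                      ((a :* d :+ c :* b) :* f :+ e :* (b :* d)) :* (b :* (d :* f)) :=
                      (a :* (d :* f) :+ (c :* f :+ e :* d) :* b) :* ((b :* d) :* f)) refl a b c d e f
                }
              ; identity =
                  (λ (quotient a b _) → solve 2 (λ a b →
                    (:0 :* b :+ a :* :1) :* b := a :* (:1 :* b)) refl a b)
                , (λ (quotient a b _) → solve 2 (λ a b →
                    (a :* :1 :+ :0 :* b) :* b := a :* (b :* :1)) refl a b)
              }
            ; inverse =
                (λ (quotient a b _) → solve 2 (λ a b →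
                  ((:- a) :* b :+ a :* b) :* :1 := :0 :* (b :* b)) refl a b)
              , (λ (quotient a b _) → solve 2 (λ a b →
                  (a :* b :+ (:- a) :* b) :* :1 := :0 :* (b :* b)) refl a b)
            ; ⁻¹-cong = λ {f} {f′} f≈ → let quotient a b _ = f; quotient a′ b′ _ = f′ in begin
                (- a) * b′    ≈⟨ solve 2 (λ a b′ → (:- a) :* b′ := :- (a :* b′)) refl a b′ ⟩
                - (a * b′)    ≈⟨ -‿cong f≈ ⟩
                - (a′ * b)    ≈⟨ solve 2 (λ a′ b → :- (a′ :* b) := (:- a′) :* b) refl a′ b ⟩
                (- a′) * b    ∎
            }
          ; comm = λ (quotient a b _) (quotient c d _) → solve 4 (λ a b c d →
              (a :* d :+ c :* b) :* (d :* b) := (c :* b :+ a :* d) :* (b :* d)) refl a b c d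
          }
        ; *-cong = λ {f} {f′} {g} {g′} f≈ g≈ →
            let quotient a b _ = f; quotient a′ b′ _ = f′
                quotient c d _ = g; quotient c′ d′ _ = g′ in begin
            (a * c) * (b′ * d′)    ≈⟨ solve 4 (λ a c b′ d′ → (a :* c) :* (b′ :* d′) := (a :* b′) :* (c :* d′)) refl a c b′ d′ ⟩
            (a * b′) * (c * d′)    ≈⟨ *-cong f≈ g≈ ⟩
            (a′ * b) * (c′ * d)    ≈⟨ solve 4 (λ a′ b c′ d → (a′ :* b) :* (c′ :* d) := (a′ :* c′) :* (b :* d)) refl a′ b c′ d ⟩
            (a′ * c′) * (b * d)    ∎
        ; *-assoc = λ (quotient a b _) (quotient c d _) (quotient e f _) →
            solve 6 (λ a b c d e f →
              ((a :* c) :* e) :* (b :* (d :* f)) := (a :* (c :* e)) :* ((b :* d) :* f)) refl a b c d e f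
        ; *-identity =
            (λ (quotient a b _) → solve 2 (λ a b → (:1 :* a) :* b := a :* (:1 :* b)) refl a b)
          , (λ (quotient a b _) → solve 2 (λ a b → (a :* :1) :* b := a :* (b :* :1)) refl a b)
        ; distrib =
            (λ (quotient a b _) (quotient c d _) (quotient e f _) →
              solve 6 (λ a b c d e f →
                (a :* (c :* f :+ e :* d)) :* ((b :* d) :* (b :* f)) :=
                ((a :* c) :* (b :* f) :+ (a :* e) :* (b :* d)) :* (b :* (d :* f))) refl a b c d e f)
          , (λ (quotient a b _) (quotient c d _) (quotient e f _) →
              solve 6 (λ a b c d e f →
                ((c :* f :+ e :* d) :* a) :* ((d :* b) :* (f :* b)) :=
                ((c :* a) :* (f :* b) :+ (e :* a) :* (d :* b)) :* ((d :* f) :* b)) refl a b c d e f)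
        }
      ; *-comm = λ (quotient a b _) (quotient c d _) → solve 4 (λ a b c d →
          (a :* c) :* (d :* b) := (c :* a) :* (b :* d)) refl a b c d
      }

module Cancellation {c ℓ} (R : CommutativeRing c ℓ) where
  open CommutativeRing R
  open import Algebra.Properties.Group +-group using (x∙y⁻¹≈ε⇒x≈y)
  open IntegerSolver R
  open ≈-Reasoning setoid

  *-cancelˡ-nonZero : (∀ a b → a * b ≈ 0# → a ≈ 0# ⊎ b ≈ 0#) →
    ∀ {a b c} → ¬ a ≈ 0# → a * b ≈ a * c → b ≈ c
  *-cancelˡ-nonZero noZeroDivisors {a} {b} {c} a≉0 ab≈ac with noZeroDivisors a (b - c) (begin
      a * (b - c)         ≈⟨ solve 3 (λ a b c → a :* (b :- c) := a :* b :- a :* c) refl a b c ⟩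
      a * b - a * c       ≈⟨ +-congʳ ab≈ac ⟩
      a * c - a * c       ≈⟨ -‿inverseʳ (a * c) ⟩
      0#                  ∎)
  ... | inj₁ a≈0   = contradiction a≈0 a≉0
  ... | inj₂ b-c≈0 = x∙y⁻¹≈ε⇒x≈y b c b-c≈0

module FractionField where
  open ℚ⟨q⟩

  *-cancelˡ : ∀ {a b c} → ¬ a P.≈ P.0# → a P.* b P.≈ a P.* c → b P.≈ c
  *-cancelˡ {a} {b} {c} =
    Cancellation.*-cancelˡ-nonZero PolynomialRing.commutativeRing P.noZeroDivisors {a} {b} {c}

  module L = Localisation.Quotients PolynomialRing.commutativeRing
    (λ p → ¬ p P.≈ P.0#) P.*-nonZero P.1≉0 (λ {a} {b} {c} → *-cancelˡ {a} {b} {c})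

  -- Both fraction types have the same components and operations, so repacking is a homomorphism by
  -- reflexivity.
  isRingMonomorphism : IsRingMonomorphism Fraction.rawRing L.rawRing
    (λ f → L.quotient (num f) (den f) (den≉0 f))
  isRingMonomorphism = record
    { isRingHomomorphism = record
      { isSemiringHomomorphism = record
        { isNearSemiringHomomorphism = record
          { +-isMonoidHomomorphism = record
            { isMagmaHomomorphism = record
              { isRelHomomorphism = record { cong = λ f≈g → f≈g }
              ; homo = λ _ _ _ → ≡.refl
              }
            ; ε-homo = λ _ → ≡.refl
            }
          ; *-homo = λ _ _ _ → ≡.refl
          }
        ; 1#-homo = λ _ → ≡.refl
        }
      ; -‿homo = λ _ _ → ≡.refl
      }
    ; injective = λ f≈g → f≈g
    }

  commutativeRing : CommutativeRing 0ℓ 0ℓ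
  commutativeRing = record
    { isCommutativeRing =
        RingMonomorphism.isCommutativeRing isRingMonomorphism L.isCommutativeRing
    }

-- Non-crossing partitions as walks on a stack of open blocks

module NonCrossing where
  open ≡ using (refl; sym; trans; cong; cong₂; subst)

  -- walks n s M lists the words of length n that may follow a prefix with blocks
  -- 0, …, M − 1, where s lists, topmost first, the blocks that can still be
  -- continued: reusing a block closes all the blocks opened after it.
  walks   : ℕ → List ℕ → ℕ → List (List ℕ)
  returns : ℕ → List ℕ → ℕ → List (List ℕ)

  walks zero    s M = [] ∷ []
  walks (suc n) s M = map (suc M ∷_) (walks n (M ∷ s) (suc M)) ++ returns n s M

  returns n []      M = []
  returns n (a ∷ s) M = map (suc a ∷_) (walks n (a ∷ s) M) ++ returns n s M

  Descending : List ℕ → Set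
  Descending = AllPairs _>_

  module _ {A : Set} where
    below : ∀ {a : A} {s} → a ∈ s → List A
    below {s = _ ∷ s} (here _)  = s
    below             (there p) = below p

    below-⊆ : ∀ {a b : A} {s} (a∈s : a ∈ s) → b ∈ a ∷ below a∈s → b ∈ s
    below-⊆ (here refl) b∈ = b∈
    below-⊆ (there a∈s) b∈ = there (below-⊆ a∈s b∈)

    below-AllPairs : ∀ {R : A → A → Set} {a s} (a∈s : a ∈ s) → AllPairs R s → AllPairs R (a ∷ below a∈s)
    below-AllPairs (here refl) s↓       = s↓
    below-AllPairs (there a∈s) (_ ∷ s↓) = below-AllPairs a∈s s↓

  <⇒∈below : ∀ {a b s} (a∈s : a ∈ s) → Descending s → b ∈ s → b < a → b ∈ below a∈s
  <⇒∈below (here refl) _        (here refl)  b<a = contradiction b<a (ℕ.<-irrefl refl)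
  <⇒∈below (here refl) _        (there b∈s)  b<a = b∈s
  <⇒∈below (there a∈s) (c> ∷ _) (here refl)  b<a = contradiction (All.lookup c> a∈s) (ℕ.<-asym b<a)
  <⇒∈below (there a∈s) (_ ∷ s↓) (there b∈s)  b<a = <⇒∈below a∈s s↓ b∈s b<a

  ∈-returns⁺ : ∀ {n s M a ρ} (a∈s : a ∈ s) → ρ ∈ walks n (a ∷ below a∈s) M → (suc a ∷ ρ) ∈ returns n s M
  ∈-returns⁺ (here refl) ρ∈ = ∈.∈-++⁺ˡ (∈.∈-map⁺ _ ρ∈)
  ∈-returns⁺ (there a∈s) ρ∈ = ∈.∈-++⁺ʳ _ (∈-returns⁺ a∈s ρ∈)

  ∈-returns⁻ : ∀ n s M {σ} → σ ∈ returns n s M →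
    ∃[ a ] ∃[ a∈s ] ∃[ ρ ] σ ≡ suc a ∷ ρ × ρ ∈ walks n (a ∷ below {a = a} {s} a∈s) M
  ∈-returns⁻ n (a ∷ s) M σ∈ with ∈.∈-++⁻ (map (suc a ∷_) (walks n (a ∷ s) M)) σ∈
  ... | inj₁ σ∈ˡ = let ρ , ρ∈ , σ≡ = ∈.∈-map⁻ _ σ∈ˡ in a , here refl , ρ , σ≡ , ρ∈
  ... | inj₂ σ∈ʳ = let b , b∈s , rest = ∈-returns⁻ n s M σ∈ʳ in b , there b∈s , rest

  -- The stack entries are distinct and below `M`, so the sublists joined by `++` differ in their
  -- first letters.
  walks-unique   : ∀ n s M → Descending (M ∷ s) → Unique (walks n s M)
  returns-unique : ∀ n s M → Descending (M ∷ s) → Unique (returns n s M)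

  walks-unique zero    s M M∷s↓           = [] ∷ []
  walks-unique (suc n) s M M∷s↓@(M> ∷ s↓) =
    Unique.++⁺ (Unique.map⁺ (proj₂ ∘ ∷-injective) (walks-unique n (M ∷ s) (suc M) ((ℕ.≤-refl ∷ All.map ℕ.m≤n⇒m≤1+n M>) ∷ M∷s↓)))
               (returns-unique n s M M∷s↓) disjoint
    where
    disjoint : Disjoint (map (suc M ∷_) (walks n (M ∷ s) (suc M))) (returns n s M)
    disjoint (v∈ , v∈′) with ∈.∈-map⁻ _ v∈ | ∈-returns⁻ n s M v∈′
    ... | _ , _ , refl | _ , M∈s , _ , refl , _ = ℕ.<-irrefl refl (All.lookup M> M∈s)

  returns-unique n []      M _                           = []
  returns-unique n (a ∷ s) M ((M>a ∷ M>) ∷ a∷s↓@(a> ∷ s↓)) =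
    Unique.++⁺ (Unique.map⁺ (proj₂ ∘ ∷-injective) (walks-unique n (a ∷ s) M ((M>a ∷ M>) ∷ a∷s↓)))
               (returns-unique n s M (M> ∷ s↓)) disjoint
    where
    disjoint : Disjoint (map (suc a ∷_) (walks n (a ∷ s) M)) (returns n s M)
    disjoint (v∈ , v∈′) with ∈.∈-map⁻ _ v∈ | ∈-returns⁻ n s M v∈′
    ... | _ , _ , refl | _ , a∈s , _ , refl , _ = ℕ.<-irrefl refl (All.lookup a> a∈s)

  _!_ : ∀ {k n} → Vec (Fin k) n → Fin n → ℕ
  w ! i = toℕ (lookup w i)

  -- w can follow a prefix in the state (s, M).  In a canonical form every letter
  -- is preceded by all smaller ones, so excluding b a b with a < b is enough.
  record Continues (s : List ℕ) (M : ℕ) {k n} (w : Vec (Fin k) n) : Set where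
    field
      growth : ∀ p a → M ≤ a → a < w ! p → ∃[ i ] i Fin.< p × w ! i ≡ a
      onto   : ∀ a → M ≤ a → a < k → ∃[ p ] w ! p ≡ a
      open∈  : ∀ p → w ! p < M → w ! p ∈ s
      -- Two conditions forbid b a b with a < b: here the first b lies in the prefix, in `avoids` it
      -- lies in `w`.
      closed : ∀ i j → i Fin.< j → w ! i < w ! j → ¬ w ! j < M
      avoids : ∀ i j l → i Fin.< j → j Fin.< l → w ! i ≡ w ! l → ¬ w ! j < w ! i
  open Continues

  module _ {s : List ℕ} {M k n : ℕ} {c : Fin k} {w : Vec (Fin k) n} where

    -- Opening block `M` moves its first letter from the word to the prefix: `avoids` with the head
    -- letter as first b becomes `closed` at the value `M`.
    new⁺ : toℕ c ≡ M → Continues (M ∷ s) (suc M) w → Continues s M (c ∷ w)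
    new⁺ refl C = record
      { growth = λ where
          zero    a M≤a a<M → contradiction (ℕ.≤-<-trans M≤a a<M) (ℕ.<-irrefl refl)
          (suc p) a M≤a a<p → case ℕ.m≤n⇒m<n∨m≡n M≤a of λ where
            (inj₁ M<a)  → let i , i<p , eq = growth C p a M<a a<p in suc i , s<s i<p , eq
            (inj₂ refl) → zero , z<s , refl
      ; onto = λ a M≤a a<k → case ℕ.m≤n⇒m<n∨m≡n M≤a of λ where
          (inj₁ M<a)  → let p , eq = onto C a M<a a<k in suc p , eq
          (inj₂ refl) → zero , refl
      ; open∈ = λ where
          zero    M<M → contradiction M<M (ℕ.<-irrefl refl)
          (suc p) p<M → case open∈ C p (ℕ.m≤n⇒m≤1+n p<M) of λ where
            (here eq)   → contradiction p<M (ℕ.<-irrefl eq)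
            (there p∈s) → p∈s
      ; closed = λ where
          zero    (suc j) _         M<j j<M → ℕ.<-asym M<j j<M
          (suc i) (suc j) (s<s i<j) w<  j<M → closed C i j i<j w< (ℕ.m≤n⇒m≤1+n j<M)
      ; avoids = λ where
          zero    (suc j) (suc l) _         (s<s j<l) eq j<M →
            closed C j l j<l (subst (w ! j <_) eq j<M) (s≤s (ℕ.≤-reflexive (sym eq)))
          (suc i) (suc j) (suc l) (s<s i<j) (s<s j<l) → avoids C i j l i<j j<l
      }

    new⁻ : toℕ c ≡ M → Continues s M (c ∷ w) → Continues (M ∷ s) (suc M) w
    new⁻ refl C = record
      { growth = λ p a M<a a<p → case growth C (suc p) a (ℕ.<⇒≤ M<a) a<p of λ where
          (zero  , _       , eq) → contradiction M<a (ℕ.<-irrefl eq)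
          (suc i , s<s i<p , eq) → i , i<p , eq
      ; onto = λ a M<a a<k → case onto C a (ℕ.<⇒≤ M<a) a<k of λ where
          (zero  , eq) → contradiction M<a (ℕ.<-irrefl eq)
          (suc p , eq) → p , eq
      ; open∈ = λ p p<1+M → case ℕ.m≤n⇒m<n∨m≡n (ℕ.s≤s⁻¹ p<1+M) of λ where
          (inj₁ p<M) → there (open∈ C (suc p) p<M)
          (inj₂ p≡M) → here p≡M
      ; closed = λ i j i<j w< j<1+M → case ℕ.m≤n⇒m<n∨m≡n (ℕ.s≤s⁻¹ j<1+M) of λ where
          (inj₁ j<M) → closed C (suc i) (suc j) (s<s i<j) w< j<M
          (inj₂ j≡M) → avoids C zero (suc i) (suc j) z<s (s<s i<j) (sym j≡M) (subst (w ! i <_) j≡M w<)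
      ; avoids = λ i j l i<j j<l → avoids C (suc i) (suc j) (suc l) (s<s i<j) (s<s j<l)
      }

    -- Popping the stack encodes `closed` for the head letter `c`: an old letter above `c` may no
    -- longer follow, which is to say that every later old letter is `c` or lies below it on the
    -- stack.
    old⁺ : Descending s → toℕ c < M → (c∈s : toℕ c ∈ s) →
      Continues (toℕ c ∷ below c∈s) M w → Continues s M (c ∷ w)
    old⁺ s↓ c<M c∈s C = record
      { growth = λ where
          zero    a M≤a a<c → contradiction (ℕ.≤-<-trans M≤a a<c) (ℕ.<-asym c<M)
          (suc p) a M≤a a<p → let i , i<p , eq = growth C p a M≤a a<p in suc i , s<s i<p , eq
      ; onto = λ a M≤a a<k → let p , eq = onto C a M≤a a<k in suc p , eq
      ; open∈ = λ where
          zero    _   → c∈s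
          (suc p) p<M → below-⊆ c∈s (open∈ C p p<M)
      ; closed = λ where
          zero    (suc j) _         c<j j<M → case open∈ C j j<M of λ where
            (here eq)  → ℕ.<-irrefl (sym eq) c<j
            (there j∈) → ℕ.<-asym c<j (All.lookup (AllPairs.head (below-AllPairs c∈s s↓)) j∈)
          (suc i) (suc j) (s<s i<j) w< → closed C i j i<j w<
      ; avoids = λ where
          zero    (suc j) (suc l) _         (s<s j<l) eq j<c →
            closed C j l j<l (subst (w ! j <_) eq j<c) (subst (_< M) eq c<M)
          (suc i) (suc j) (suc l) (s<s i<j) (s<s j<l) → avoids C i j l i<j j<l
      }

    old⁻ : Descending s → toℕ c < M → (c∈s : toℕ c ∈ s) →
      Continues s M (c ∷ w) → Continues (toℕ c ∷ below c∈s) M w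
    old⁻ s↓ c<M c∈s C = record
      { growth = λ p a M≤a a<p → case growth C (suc p) a M≤a a<p of λ where
          (zero  , _       , refl) → contradiction c<M (ℕ.≤⇒≯ M≤a)
          (suc i , s<s i<p , eq)   → i , i<p , eq
      ; onto = λ a M≤a a<k → case onto C a M≤a a<k of λ where
          (zero  , refl) → contradiction c<M (ℕ.≤⇒≯ M≤a)
          (suc p , eq)   → p , eq
      ; open∈ = λ p p<M → case ℕ.<-cmp (w ! p) (toℕ c) of λ where
          (tri< p<c _ _) → there (<⇒∈below c∈s s↓ (open∈ C (suc p) p<M) p<c)
          (tri≈ _ p≡c _) → here p≡c
          (tri> _ _ c<p) → contradiction p<M (closed C zero (suc p) z<s c<p)
      ; closed = λ i j i<j → closed C (suc i) (suc j) (s<s i<j)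
      ; avoids = λ i j l i<j j<l → avoids C (suc i) (suc j) (suc l) (s<s i<j) (s<s j<l)
      }

  walks-complete : ∀ {k n s M} (w : Vec (Fin k) n) → Descending (M ∷ s) → Continues s M w → letters w ∈ walks n s M
  walks-complete             []      _                   C = here refl
  walks-complete {s = s} {M} (c ∷ w) M∷s↓@(M> ∷ s↓) C with ℕ.<-cmp (toℕ c) M
  ... | tri≈ _ refl _ = ∈.∈-++⁺ˡ $ ∈.∈-map⁺ _ $
    walks-complete w ((ℕ.≤-refl ∷ All.map ℕ.m≤n⇒m≤1+n M>) ∷ M∷s↓) (new⁻ refl C)
  -- `growth` would demand the letter `M` at a position before the first.
  ... | tri> _ _ M<c with () ← growth C zero M ℕ.≤-refl M<c .proj₂ .proj₁
  ... | tri< c<M _ _ = let c∈s = open∈ C zero c<M in ∈.∈-++⁺ʳ _ $ ∈-returns⁺ c∈s $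
    walks-complete w (All.tabulate (λ b∈ → All.lookup M> (below-⊆ c∈s b∈)) ∷ below-AllPairs c∈s s↓) (old⁻ s↓ c<M c∈s C)

  -- The number of blocks is known only when the walk ends, where it is the current `M`; hence the
  -- existential `k`, bounded below by `M`.
  walks-sound : ∀ n s M → Descending (M ∷ s) → ∀ {ρ} → ρ ∈ walks n s M →
    ∃[ k ] M ≤ k × ∃[ w ] ρ ≡ letters {k} {n} w × Continues s M w
  walks-sound zero s M _ (here refl) = M , ℕ.≤-refl , [] , refl , record
    { growth = λ ()
    ; onto   = λ a M≤a a<M → contradiction (ℕ.≤-<-trans M≤a a<M) (ℕ.<-irrefl refl)
    ; open∈  = λ ()
    ; closed = λ ()
    ; avoids = λ ()
    }
  walks-sound (suc n) s M M∷s↓@(M> ∷ s↓) ρ∈ with ∈.∈-++⁻ (map (suc M ∷_) (walks n (M ∷ s) (suc M))) ρ∈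
  ... | inj₁ ρ∈ˡ with ∈.∈-map⁻ _ ρ∈ˡ
  ...   | ρ′ , ρ′∈ , refl with walks-sound n (M ∷ s) (suc M) ((ℕ.≤-refl ∷ All.map ℕ.m≤n⇒m≤1+n M>) ∷ M∷s↓) ρ′∈
  ...     | k , M<k , w , refl , C =
    k , ℕ.<⇒≤ M<k , fromℕ< M<k ∷ w , cong (λ c → suc c ∷ _) (sym (Fin.toℕ-fromℕ< M<k)) , new⁺ (Fin.toℕ-fromℕ< M<k) C
  walks-sound (suc n) s M M∷s↓@(M> ∷ s↓) ρ∈ | inj₂ ρ∈ʳ with ∈-returns⁻ n s M ρ∈ʳ
  ... | a , a∈s , ρ′ , refl , ρ′∈
    with walks-sound n (a ∷ below a∈s) M (All.tabulate (λ b∈ → All.lookup M> (below-⊆ a∈s b∈)) ∷ below-AllPairs a∈s s↓) ρ′∈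
  ...   | k , M≤k , w , refl , C = let a<M = All.lookup M> a∈s in
    k , M≤k , fromℕ< (ℕ.≤-trans a<M M≤k) ∷ w , cong (λ c → suc c ∷ _) (sym (Fin.toℕ-fromℕ< (ℕ.≤-trans a<M M≤k))) ,
    old (ℕ.≤-trans a<M M≤k)
    where
    old : ∀ a<k → Continues s M (fromℕ< {a} {k} a<k ∷ w)
    old a<k with fromℕ< a<k | Fin.toℕ-fromℕ< a<k
    ... | c | refl = old⁺ s↓ (All.lookup M> a∈s) a∈s C

  blockMin : ∀ {k n} (w : Vec (Fin k) n) i → ∃[ j ] j Fin.≤ i × IsBlockMin w j × lookup w j ≡ lookup w i
  blockMin {n = n} w i with Fin.¬∀⟶∃¬-smallest n (λ j → lookup w j ≢ lookup w i) (λ j → ¬? (lookup w j Fin.≟ lookup w i)) (λ ne → ne i refl)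
  ... | j , ¬w≢ , before with decidable-stable (lookup w j Fin.≟ lookup w i) ¬w≢
  ...   | wj≡wi = j , minimal i refl , (λ l wl≡wj → minimal l (trans wl≡wj wj≡wi)) , wj≡wi
    where
    minimal : ∀ l → lookup w l ≡ lookup w i → j Fin.≤ l
    minimal l wl≡wi = ℕ.≮⇒≥ λ l<j → before (fromℕ< l<j) $
      subst (λ l′ → lookup w l′ ≡ lookup w i)
        (Fin.toℕ-injective (trans (sym (Fin.toℕ-fromℕ< l<j)) (sym (Fin.toℕ-inject (fromℕ< l<j))))) wl≡wi

  nonCrossing⇒continues : ∀ {k n} (w : Vec (Fin k) n) → IsNonCrossingPartition w → Continues [] 0 w
  nonCrossing⇒continues {k} w ((onto , increasing) , noCrossing) = record
    { growth = precedes
    ; onto   = λ a _ a<k → let p , eq = onto (fromℕ< a<k) in p , trans (cong toℕ eq) (Fin.toℕ-fromℕ< a<k)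
    ; open∈  = λ _ ()
    ; closed = λ _ _ _ _ ()
    ; avoids = λ i j l i<j j<l wi≡wl wj<wi →
        let h , h<i , wh≡wj = precedes i (w ! j) z≤n wj<wi in
        noCrossing (h , i , j , l , h<i , i<j , j<l , Fin.toℕ-injective wh≡wj , Fin.toℕ-injective wi≡wl ,
                    subst (_< w ! i) (sym wh≡wj) wj<wi)
    }
    where
    -- The minimum of block `a` comes before that of the block of `w ! p`, as minima increase with
    -- labels, and the latter minimum is at most `p`.
    precedes : ∀ p a → 0 ≤ a → a < w ! p → ∃[ i ] i Fin.< p × w ! i ≡ a
    precedes p a _ a<wp =
      let a<k               = ℕ.<-trans a<wp (Fin.toℕ<n (lookup w p))
          i₀ , wi₀≡a        = onto (fromℕ< a<k)
          i , _   , min , eq  = blockMin w i₀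
          j , j≤p , min′ , eq′ = blockMin w p
          wi≡a              = trans (cong toℕ (trans eq wi₀≡a)) (Fin.toℕ-fromℕ< a<k)
          wi<wj             = ≡.subst₂ _<_ (sym wi≡a) (cong toℕ (sym eq′)) a<wp
      in i , ℕ.<-≤-trans (increasing i j min min′ wi<wj) j≤p , wi≡a

  continues⇒nonCrossing : ∀ {k n} (w : Vec (Fin k) n) → Continues [] 0 w → IsNonCrossingPartition w
  continues⇒nonCrossing w C =
    ( (λ a → let p , eq = onto C (toℕ a) z≤n (Fin.toℕ<n a) in p , Fin.toℕ-injective eq)
    -- `growth` places the letter of `i` somewhere before `j`, and the block minimum `i` is no later
    -- than that.
    , λ i j min _ wi<wj →
        let h , h<j , wh≡wi = growth C j (w ! i) z≤n wi<wj in
        ℕ.≤-<-trans (min h (Fin.toℕ-injective wh≡wi)) h<j )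
    , λ (i₁ , i₂ , i₃ , i₄ , _ , i₂<i₃ , i₃<i₄ , w₁≡w₃ , w₂≡w₄ , w₁<w₂) →
        avoids C i₂ i₃ i₄ i₂<i₃ i₃<i₄ (cong toℕ w₂≡w₄) (subst (λ c → toℕ c < w ! i₂) w₁≡w₃ w₁<w₂)

  allWords-complete : ∀ {k n} (w : Vec (Fin k) n) → w ∈ allWords k n
  allWords-complete []      = here refl
  allWords-complete (c ∷ w) = ∈.∈-cartesianProductWith⁺ _∷_ (∈.∈-allFin c) (allWords-complete w)

  allWords-unique : ∀ k n → Unique (allWords k n)
  allWords-unique k zero    = [] ∷ []
  allWords-unique k (suc n) =
    Unique.cartesianProductWith⁺ _∷_ (λ { refl → refl , refl }) (Unique.allFin⁺ k) (allWords-unique k n)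

  letters-injective : ∀ {k n} (v w : Vec (Fin k) n) → letters v ≡ letters w → v ≡ w
  letters-injective []      []      _  = refl
  letters-injective (c ∷ v) (d ∷ w) eq =
    let c≡d , v≡w = ∷-injective eq in
    cong₂ _∷_ (Fin.toℕ-injective (ℕ.suc-injective c≡d)) (letters-injective v w v≡w)

  letters-! : ∀ {k l n} (v : Vec (Fin k) n) (w : Vec (Fin l) n) → letters v ≡ letters w → ∀ i → v ! i ≡ w ! i
  letters-! (c ∷ v) (d ∷ w) eq zero    = ℕ.suc-injective (proj₁ (∷-injective eq))
  letters-! (c ∷ v) (d ∷ w) eq (suc i) = letters-! v w (proj₂ (∷-injective eq)) i

  -- If l < k, the letter with index l occurs in `v` but is out of range for `w`. By symmetry the
  -- letters determine the number of blocks, which keeps the parts of `NC n` for different `k`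
  -- disjoint.
  blocks-≤ : ∀ {k l n} (v : Vec (Fin k) n) (w : Vec (Fin l) n) → BlocksNonempty v → letters v ≡ letters w → k ≤ l
  blocks-≤ {k} {l} v w onto eq = ℕ.≮⇒≥ λ l<k →
    let p , vp≡l = onto (fromℕ< l<k) in
    ℕ.<-irrefl (trans (sym (letters-! v w eq p)) (trans (cong toℕ vp≡l) (Fin.toℕ-fromℕ< l<k)))
      (Fin.toℕ<n (lookup w p))

  blocks-≤-length : ∀ {k n} (w : Vec (Fin k) n) → BlocksNonempty w → k ≤ n
  blocks-≤-length w onto = Fin.injective⇒≤ {f = proj₁ ∘ onto} λ {a} {b} eq →
    trans (sym (proj₂ (onto a))) (trans (cong (lookup w) eq) (proj₂ (onto b)))

  module _ (n : ℕ) where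
    private
      NCₖ : ℕ → List (List ℕ)
      NCₖ k = map letters (List.filter isNonCrossingPartition? (allWords k n))

    ∈-NCₖ⁻ : ∀ k {ρ} → ρ ∈ NCₖ k → ∃[ w ] ρ ≡ letters {k} {n} w × IsNonCrossingPartition w
    ∈-NCₖ⁻ k ρ∈ = let w , w∈ , ρ≡ = ∈.∈-map⁻ letters ρ∈ in
      w , ρ≡ , proj₂ (∈.∈-filter⁻ isNonCrossingPartition? {xs = allWords k n} w∈)

    ∈-NC⁻ : ∀ {ρ} → ρ ∈ NC n → ∃[ k ] ∃[ w ] ρ ≡ letters {k} {n} w × IsNonCrossingPartition w
    ∈-NC⁻ ρ∈ = let k , _ , ρ∈ₖ = find (∈.∈-concatMap⁻ NCₖ {xs = upTo (suc n)} ρ∈) in k , ∈-NCₖ⁻ k ρ∈ₖ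

    ∈-NC⁺ : ∀ {k} (w : Vec (Fin k) n) → IsNonCrossingPartition w → letters w ∈ NC n
    ∈-NC⁺ w nc@((onto , _) , _) = ∈.∈-concatMap⁺ NCₖ {xs = upTo (suc n)} $
      lose (∈.∈-upTo⁺ (s≤s (blocks-≤-length w onto))) $
      ∈.∈-map⁺ letters (∈.∈-filter⁺ isNonCrossingPartition? (allWords-complete w) nc)

    NC-unique : Unique (NC n)
    NC-unique = Unique.concat⁺
      (All.map⁺ (All.universal (λ k → Unique.map⁺ (letters-injective _ _) (Unique.filter⁺ isNonCrossingPartition? (allWords-unique k n))) (upTo (suc n))))
      (AllPairs.map⁺ (AllPairs.map disjoint (Unique.upTo⁺ (suc n))))
      where
      disjoint : ∀ {k l} → k ≢ l → Disjoint (NCₖ k) (NCₖ l)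
      disjoint {k} {l} k≢l (ρ∈ , ρ∈′) with ∈-NCₖ⁻ k ρ∈ | ∈-NCₖ⁻ l ρ∈′
      ... | v , refl , (onto , _) , _ | w , eq , (onto′ , _) , _ =
        k≢l (ℕ.≤-antisym (blocks-≤ v w onto eq) (blocks-≤ w v onto′ (sym eq)))

    -- Duplicate-free lists with the same members are permutations of each other, and a sum of
    -- weights is invariant under permutation.
    NC↭walks : NC n ↭ walks n [] 0
    NC↭walks = ∼bag⇒↭ $ unique∧set⇒bag NC-unique (walks-unique n [] 0 ([] ∷ [])) $ mk⇔
      (λ ρ∈ → let k , w , ρ≡ , nc = ∈-NC⁻ ρ∈ in
        subst (_∈ walks n [] 0) (sym ρ≡) (walks-complete w ([] ∷ []) (nonCrossing⇒continues w nc)))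
      (λ ρ∈ → let k , _ , w , ρ≡ , C = walks-sound n [] 0 ([] ∷ []) ρ∈ in
        subst (_∈ NC n) (sym ρ≡) (∈-NC⁺ w (continues⇒nonCrossing w C)))

-- Occurrences of the two patterns in terms of runs

module Occurrences where
  open import Data.Nat.Base using (_+_)
  open ≡ using (refl; sym; trans; cong)

  length-filter-applyUpTo-suc : ∀ {P : ℕ → Set} (P? : Decidable P) f n →
    length (filter P? (applyUpTo (suc ∘ f) n)) ≡ length (filter (P? ∘ suc) (applyUpTo f n))
  length-filter-applyUpTo-suc P? f zero    = refl
  length-filter-applyUpTo-suc P? f (suc n) with does (P? (suc (f 0)))
  ... | true  = cong suc (length-filter-applyUpTo-suc P? (f ∘ suc) n)
  ... | false = length-filter-applyUpTo-suc P? (f ∘ suc) n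

  module _ (τ : List ℕ) (c : ℕ) (ρ : List ℕ) where
    μ-∷-≤ : length τ ≤ suc (length ρ) →
      μ τ (c ∷ ρ) ≡ length (filter (occursAt? τ (c ∷ ρ)) (upTo (suc (suc (length ρ) ∸ length τ))))
    μ-∷-≤ τ≤ = cong (length ∘ filter (occursAt? τ (c ∷ ρ)) ∘ upTo) (ℕ.+-∸-assoc 1 τ≤)

    μ-shift : length (filter (occursAt? τ (c ∷ ρ)) (applyUpTo suc (suc (length ρ) ∸ length τ))) ≡ μ τ ρ
    μ-shift = length-filter-applyUpTo-suc (occursAt? τ (c ∷ ρ)) id (suc (length ρ) ∸ length τ)

    μ-∷-yes : OccursAt τ (c ∷ ρ) 0 → μ τ (c ∷ ρ) ≡ suc (μ τ ρ)
    μ-∷-yes occ = trans (μ-∷-≤ τ≤) $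
      trans (cong length (filter-accept (occursAt? τ (c ∷ ρ)) occ)) (cong suc μ-shift)
      where
      τ≤ : length τ ≤ suc (length ρ)
      τ≤ = ℕ.m⊓n≡m⇒m≤n (trans (sym (length-take (length τ) (c ∷ ρ))) (proj₁ occ))

    μ-∷-no : ¬ OccursAt τ (c ∷ ρ) 0 → μ τ (c ∷ ρ) ≡ μ τ ρ
    μ-∷-no ¬occ with length τ ℕ.≤? suc (length ρ)
    ... | yes τ≤ = trans (μ-∷-≤ τ≤) $
      trans (cong length (filter-reject (occursAt? τ (c ∷ ρ)) ¬occ)) μ-shift
    -- The pattern is longer than the word, so truncated subtraction leaves no starting index on
    -- either side.
    ... | no  τ≰ = trans (empty (ℕ.m≤n⇒m∸n≡0 (ℕ.≰⇒> τ≰))) (sym (empty (ℕ.m≤n⇒m∸n≡0 (ℕ.<⇒≤ (ℕ.≰⇒> τ≰)))))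
      where
      empty : ∀ {P : ℕ → Set} {P? : Decidable P} {n} → n ≡ 0 → length (filter P? (upTo n)) ≡ 0
      empty refl = refl

  μ-[] : ∀ c τ → μ (c ∷ τ) [] ≡ 0
  μ-[] c τ = cong (λ n → length (filter (occursAt? (c ∷ τ) []) (upTo n))) (ℕ.0∸n≡0 (length τ))

  -- With `a ≢_` for `R` a run of `a` in front of the word is maximal; with `_< a` it ends in a
  -- descent or with the word.
  data Breaks (R : ℕ → Set) : List ℕ → Set where
    []  : Breaks R []
    _∷_ : ∀ {b} → R b → ∀ ρ → Breaks R (b ∷ ρ)

  -- A weakening of an occurrence that survives removal of leading letters, because every letter is
  -- compared only with the fixed pair `(a , 1)`. It still determines how the run of `a` must look.
  Fits : ℕ → List ℕ → List ℕ → Set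
  Fits a τ ρ = length (take (length τ) ρ) ≡ length τ × All (SameOrder (a , 1)) (zip (take (length τ) ρ) τ)

  occurs⇒fits : ∀ {a τ ρ} → OccursAt (1 ∷ τ) (a ∷ ρ) 0 → Fits a (1 ∷ τ) (a ∷ ρ)
  occurs⇒fits (τ≤ , same ∷ _) = τ≤ , same

  fits-tail : ∀ {a c τ ρ d} → Fits a (d ∷ τ) (c ∷ ρ) → Fits a τ ρ
  fits-tail (τ≤ , _ ∷ same) = ℕ.suc-injective τ≤ , same

  fits-1 : ∀ {a c τ ρ} → Fits a (1 ∷ τ) (c ∷ ρ) → a ≡ c
  fits-1 (_ , (_ , eq) ∷ _) = Equivalence.from eq refl

  fits-2 : ∀ {a c τ ρ} → Fits a (2 ∷ τ) (c ∷ ρ) → a < c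
  fits-2 (_ , (lt , _) ∷ _) = Equivalence.from lt (s<s z<s)

  fits-1^ : ∀ {a} m r {σ} → Breaks (a ≢_) σ → Fits a (1^ m) (replicate r a ++ σ) → m ≤ r
  fits-1^ zero    r       _        _        = z≤n
  fits-1^ (suc m) zero    []       (() , _)
  fits-1^ (suc m) zero    (a≢b ∷ _) fits    = contradiction (fits-1 {τ = 1^ m} fits) a≢b
  fits-1^ (suc m) (suc r) breaks   fits     = s≤s (fits-1^ m r breaks (fits-tail {τ = 1^ m} fits))

  fits-1^2 : ∀ {a} m r {σ} → Breaks (a ≢_) σ → Fits a (1^ m ++ [ 2 ]) (replicate r a ++ σ) →
    r ≡ m × ∃[ b ] ∃[ ρ ] σ ≡ b ∷ ρ × a < b
  fits-1^2 zero    zero    []         (() , _)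
  fits-1^2 zero    zero    (_ ∷ ρ)    fits = refl , _ , ρ , refl , fits-2 {τ = []} {ρ = ρ} fits
  fits-1^2 {a} zero    (suc r) {σ} _          fits = contradiction (fits-2 {τ = []} {ρ = replicate r a ++ σ} fits) (ℕ.<-irrefl refl)
  fits-1^2 (suc m) zero    []         (() , _)
  fits-1^2 (suc m) zero    (a≢b ∷ _)  fits = contradiction (fits-1 {τ = 1^ m ++ [ 2 ]} fits) a≢b
  fits-1^2 (suc m) (suc r) breaks     fits = let r≡m , up = fits-1^2 m r breaks (fits-tail {τ = 1^ m ++ [ 2 ]} fits) in cong suc r≡m , up

  -- The letters a and b stand for the pattern letters 1 and 2.
  Standardised : ℕ → ℕ → ℕ × ℕ → Set
  Standardised a b p = p ≡ (a , 1) ⊎ p ≡ (b , 2)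

  standardised⇒sameOrder : ∀ {a b p p′} → a < b → Standardised a b p → Standardised a b p′ → SameOrder p p′
  standardised⇒sameOrder a<b (inj₁ refl) (inj₁ refl) = irrefl , mk⇔ (λ _ → refl) (λ _ → refl)
    where irrefl = mk⇔ (λ a<a → contradiction a<a (ℕ.<-irrefl refl)) λ { (s<s ()) }
  standardised⇒sameOrder a<b (inj₁ refl) (inj₂ refl) =
    mk⇔ (λ _ → s<s z<s) (λ _ → a<b) , mk⇔ (λ a≡b → contradiction a<b (ℕ.<-irrefl a≡b)) λ ()
  standardised⇒sameOrder a<b (inj₂ refl) (inj₁ refl) =
    mk⇔ (λ b<a → contradiction b<a (ℕ.<-asym a<b)) (λ { (s<s ()) }) , mk⇔ (λ b≡a → contradiction a<b (ℕ.<-irrefl (sym b≡a))) λ ()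
  standardised⇒sameOrder a<b (inj₂ refl) (inj₂ refl) = irrefl , mk⇔ (λ _ → refl) (λ _ → refl)
    where irrefl = mk⇔ (λ a<a → contradiction a<a (ℕ.<-irrefl refl)) λ { (s<s (s<s ())) }

  standardised⇒orderIsomorphic : ∀ {a b σ τ} → a < b → length σ ≡ length τ →
    All (Standardised a b) (zip σ τ) → OrderIsomorphic σ τ
  standardised⇒orderIsomorphic a<b len st =
    len , All.map (λ p → All.map (standardised⇒sameOrder a<b p) st) st

  occurs-1^ : ∀ a m r σ → m ≤ r → OccursAt (1^ m) (replicate r a ++ σ) 0
  -- The letter 2 is absent from `1^ m`, so any value above `a`, here `suc a`, can play its part.
  occurs-1^ a m r σ m≤r = let len , st = go m r m≤r in standardised⇒orderIsomorphic (ℕ.n<1+n a) len st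
    where
    go : ∀ m r → m ≤ r → let π = take (length (1^ m)) (replicate r a ++ σ) in
      length π ≡ length (1^ m) × All (Standardised a (suc a)) (zip π (1^ m))
    go zero    r       _         = refl , []
    go (suc m) (suc r) (s≤s m≤r) = let len , st = go m r m≤r in cong suc len , inj₁ refl ∷ st

  occurs-1^2 : ∀ {a b} m σ → a < b → OccursAt (1^ m ++ [ 2 ]) (replicate m a ++ b ∷ σ) 0
  occurs-1^2 {a} {b} m σ a<b = let len , st = go m in standardised⇒orderIsomorphic a<b len st
    where
    go : ∀ m → let τ = 1^ m ++ [ 2 ]; π = take (length τ) (replicate m a ++ b ∷ σ) in
      length π ≡ length τ × All (Standardised a b) (zip π τ)
    go zero    = refl , inj₂ refl ∷ []
    go (suc m) = let len , st = go m in cong suc len , inj₁ refl ∷ st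

  -- An occurrence starts at a letter of the run exactly when at least `k + 1` letters of the run
  -- remain.
  μ-1^ : ∀ {a} k r {σ} → Breaks (a ≢_) σ → μ (1^ suc k) (replicate r a ++ σ) ≡ (r ∸ k) + μ (1^ suc k) σ
  μ-1^     k zero    {σ} _      = cong (_+ μ (1^ suc k) σ) (sym (ℕ.0∸n≡0 k))
  μ-1^ {a} k (suc r) {σ} breaks with k ℕ.≤? r
  ... | yes k≤r = begin
    μ (1^ suc k) (replicate (suc r) a ++ σ)   ≡⟨ μ-∷-yes (1^ suc k) a _ (occurs-1^ a (suc k) (suc r) σ (s≤s k≤r)) ⟩
    suc (μ (1^ suc k) (replicate r a ++ σ))   ≡⟨ cong suc (μ-1^ k r breaks) ⟩
    suc (r ∸ k + μ (1^ suc k) σ)              ≡⟨ cong (_+ μ (1^ suc k) σ) (ℕ.+-∸-assoc 1 k≤r) ⟨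
    suc r ∸ k + μ (1^ suc k) σ                ∎
    where open ≡.≡-Reasoning
  ... | no  k≰r = begin
    μ (1^ suc k) (replicate (suc r) a ++ σ)   ≡⟨ μ-∷-no (1^ suc k) a _ (λ occ → k≰r (ℕ.s≤s⁻¹ (fits-1^ (suc k) (suc r) breaks (occurs⇒fits {τ = 1^ k} occ)))) ⟩
    μ (1^ suc k) (replicate r a ++ σ)         ≡⟨ μ-1^ k r breaks ⟩
    r ∸ k + μ (1^ suc k) σ                    ≡⟨ cong (_+ μ (1^ suc k) σ) (trans (ℕ.m≤n⇒m∸n≡0 (ℕ.<⇒≤ (ℕ.≰⇒> k≰r))) (sym (ℕ.m≤n⇒m∸n≡0 (ℕ.≰⇒> k≰r)))) ⟩
    suc r ∸ k + μ (1^ suc k) σ                ∎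
    where open ≡.≡-Reasoning

  μ-1^2-down : ∀ {a} k r {σ} → Breaks (_< a) σ →
    μ (1^ suc k ++ [ 2 ]) (replicate r a ++ σ) ≡ μ (1^ suc k ++ [ 2 ]) σ
  μ-1^2-down     k zero    _      = refl
  μ-1^2-down {a} k (suc r) {σ} breaks =
    trans (μ-∷-no (1^ suc k ++ [ 2 ]) a _ (no-occurrence breaks)) (μ-1^2-down k r breaks)
    where
    no-occurrence : ∀ {σ} → Breaks (_< a) σ → ¬ OccursAt (1^ suc k ++ [ 2 ]) (replicate (suc r) a ++ σ) 0
    no-occurrence []        occ with () ← fits-1^2 (suc k) (suc r) [] (occurs⇒fits {τ = 1^ k ++ [ 2 ]} occ) .proj₂ .proj₂ .proj₂ .proj₁
    no-occurrence (b<a ∷ ρ) occ with fits-1^2 (suc k) (suc r) (ℕ.>⇒≢ b<a ∷ ρ) (occurs⇒fits {τ = 1^ k ++ [ 2 ]} occ)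
    ... | _ , _ , _ , refl , a<b = ℕ.<-asym a<b b<a

  -- The larger letter must come right after the `k + 1` equal ones, so only the start with exactly
  -- `k + 1` letters of the run remaining counts; hence the cap at 1.
  μ-1^2-up : ∀ {a b} k r σ → a < b →
    μ (1^ suc k ++ [ 2 ]) (replicate r a ++ b ∷ σ) ≡ ((r ∸ k) ⊓ 1) + μ (1^ suc k ++ [ 2 ]) (b ∷ σ)
  μ-1^2-up {b = b} k zero σ a<b = cong (λ n → n ⊓ 1 + μ (1^ suc k ++ [ 2 ]) (b ∷ σ)) (sym (ℕ.0∸n≡0 k))
  μ-1^2-up {a} {b} k (suc r) σ a<b with r ℕ.≟ k
  ... | yes refl = begin
    μ (1^ suc k ++ [ 2 ]) (replicate (suc k) a ++ b ∷ σ)      ≡⟨ μ-∷-yes (1^ suc k ++ [ 2 ]) a _ (occurs-1^2 (suc k) σ a<b) ⟩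
    suc (μ (1^ suc k ++ [ 2 ]) (replicate k a ++ b ∷ σ))      ≡⟨ cong suc (μ-1^2-up k k σ a<b) ⟩
    suc ((k ∸ k) ⊓ 1 + μ (1^ suc k ++ [ 2 ]) (b ∷ σ))         ≡⟨ cong (λ n → suc (n ⊓ 1 + μ (1^ suc k ++ [ 2 ]) (b ∷ σ))) (ℕ.n∸n≡0 k) ⟩
    1 + μ (1^ suc k ++ [ 2 ]) (b ∷ σ)                         ≡⟨ cong (λ n → n ⊓ 1 + μ (1^ suc k ++ [ 2 ]) (b ∷ σ)) (ℕ.m+n∸n≡m 1 k) ⟨
    (suc k ∸ k) ⊓ 1 + μ (1^ suc k ++ [ 2 ]) (b ∷ σ)           ∎
    where open ≡.≡-Reasoning
  ... | no  r≢k = trans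
    (μ-∷-no (1^ suc k ++ [ 2 ]) a _ λ occ → r≢k $ ℕ.suc-injective $
      fits-1^2 (suc k) (suc r) (ℕ.<⇒≢ a<b ∷ σ) (occurs⇒fits {τ = 1^ k ++ [ 2 ]} occ) .proj₁)
    (trans (μ-1^2-up k r σ a<b) (cong (_+ μ (1^ suc k ++ [ 2 ]) (b ∷ σ)) (capped k r r≢k)))
    where
    capped : ∀ k r → r ≢ k → (r ∸ k) ⊓ 1 ≡ (suc r ∸ k) ⊓ 1
    capped zero    zero    r≢k = contradiction refl r≢k
    capped zero    (suc r) r≢k = trans (cong suc (ℕ.⊓-zeroʳ r)) (cong suc (sym (ℕ.⊓-zeroʳ (suc r))))
    capped (suc k) zero    r≢k = cong (_⊓ 1) (sym (ℕ.0∸n≡0 k))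
    capped (suc k) (suc r) r≢k = capped k r (r≢k ∘ cong suc)

open NonCrossing
open Occurrences

-- Weighted sums over walks and the equations for their generating functions

module WeightedSum {c ℓ} (K : CommutativeRing c ℓ) {A : Set} where
  open CommutativeRing K
  open IntegerSolver K
  open ≈-Reasoning setoid

  Σ[_] : (A → Carrier) → List A → Carrier
  Σ[ w ] = foldr _+_ 0# ∘ map w

  module _ (w : A → Carrier) where
    Σ-++ : ∀ xs ys → Σ[ w ] (xs ++ ys) ≈ Σ[ w ] xs + Σ[ w ] ys
    Σ-++ []       ys = sym (+-identityˡ _)
    Σ-++ (x ∷ xs) ys = trans (+-congˡ (Σ-++ xs ys)) (sym (+-assoc _ _ _))

    Σ-↭ : ∀ {xs ys} → xs ↭ ys → Σ[ w ] xs ≈ Σ[ w ] ys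
    Σ-↭ ↭.refl          = refl
    Σ-↭ (↭.prep _ p)    = +-congˡ (Σ-↭ p)
    Σ-↭ (↭.swap x y p)  = trans (+-congˡ (+-congˡ (Σ-↭ p)))
      (solve 3 (λ a b s → a :+ (b :+ s) := b :+ (a :+ s)) refl (w x) (w y) _)
    Σ-↭ (↭.trans p p′)  = trans (Σ-↭ p) (Σ-↭ p′)

  Σ-map : ∀ v w f a → (∀ x → v (f x) ≈ a * w x) → ∀ xs → Σ[ v ] (map f xs) ≈ a * Σ[ w ] xs
  Σ-map v w f a eq []       = sym (zeroʳ a)
  Σ-map v w f a eq (x ∷ xs) = begin
    v (f x) + Σ[ v ] (map f xs)   ≈⟨ +-cong (eq x) (Σ-map v w f a eq xs) ⟩
    a * w x + a * Σ[ w ] xs       ≈⟨ distribˡ _ _ _ ⟨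
    a * (w x + Σ[ w ] xs)         ∎

-- The weight of a walk splits into the weights of its runs: a run of length r
-- contributes u r if it is followed by a larger letter, and e r otherwise.
module Transfer {c ℓ} (K : CommutativeRing c ℓ) (e u : ℕ → CommutativeRing.Carrier K) where
  open CommutativeRing K
  open WeightedSum K
  open IntegerSolver K
  open PowerSeries rawRing using (Series; const; x)
  private module S where
    open CommutativeRing (SeriesRing.commutativeRing K) public using (_≈_; _+_; _*_; 1#)
    open SeriesRing K public
  open ≈-Reasoning setoid

  -- V n d r is the total weight of the walks of length n above d open
  -- blocks, preceded by a run of length r of the top block; ΣV sums over the
  -- block returned to.
  V  : ℕ → ℕ → ℕ → Carrier
  ΣV : ℕ → ℕ → Carrier

  V zero    d r = e r
  V (suc n) d r = V n d (suc r) + u r * V n (suc d) 1 + e r * ΣV n d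

  ΣV n zero    = 0#
  ΣV n (suc d) = V n d 1 + ΣV n d

  F : Series
  F zero    = 1#
  F (suc n) = V n 0 1

  module _ (w : List ℕ → Carrier)
    (start    : w [] ≈ 1#)
    (run-end  : ∀ a r → w (replicate (suc r) a ++ []) ≈ e (suc r))
    (run-up   : ∀ {a b} r σ → a < b → w (replicate (suc r) a ++ b ∷ σ) ≈ u (suc r) * w (b ∷ σ))
    (run-down : ∀ {a b} r σ → b < a → w (replicate (suc r) a ++ b ∷ σ) ≈ e (suc r) * w (b ∷ σ))
    where

    replicate-++-∷ : ∀ r (a : ℕ) ρ → replicate r a ++ a ∷ ρ ≡ replicate (suc r) a ++ ρ
    replicate-++-∷ zero    a ρ = ≡.refl
    replicate-++-∷ (suc r) a ρ = ≡.cong (a ∷_) (replicate-++-∷ r a ρ)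

    -- The pending run stays in front of `ρ`, since its weight is known only once the next letter is
    -- seen. Of the stack only the number of blocks below the top survives in the sum. The run is
    -- never empty, hence `suc r`.
    Σ-walks   : ∀ n a s M r → Descending (M ∷ a ∷ s) →
      Σ[ (λ ρ → w (replicate (suc r) (suc a) ++ ρ)) ] (walks n (a ∷ s) M) ≈ V n (length s) (suc r)
    Σ-returns : ∀ n a s M r → Descending (M ∷ a ∷ s) →
      Σ[ (λ ρ → w (replicate (suc r) (suc a) ++ ρ)) ] (returns n s M) ≈ e (suc r) * ΣV n (length s)

    Σ-walks zero    a s M r ↓ = trans (+-identityʳ _) (run-end (suc a) r)
    Σ-walks (suc n) a s M r ↓@((M>a ∷ M>) ∷ a∷s↓) = begin
      Σ[ wᵣ ] (map (suc M ∷_) up ++ map (suc a ∷_) stay ++ returns n s M)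
        ≈⟨ Σ-++ wᵣ (map (suc M ∷_) up) _ ⟩
      Σ[ wᵣ ] (map (suc M ∷_) up) + Σ[ wᵣ ] (map (suc a ∷_) stay ++ returns n s M)
        ≈⟨ +-cong (Σ-map wᵣ (w ∘ (suc M ∷_)) (suc M ∷_) (u (suc r)) (λ ρ → run-up r ρ (s<s M>a)) up)
                  (Σ-++ wᵣ (map (suc a ∷_) stay) _) ⟩
      u (suc r) * Σ[ w ∘ (suc M ∷_) ] up + (Σ[ wᵣ ] (map (suc a ∷_) stay) + Σ[ wᵣ ] (returns n s M))
        ≈⟨ +-cong (*-congˡ (Σ-walks n M (a ∷ s) (suc M) 0 ((ℕ.≤-refl ∷ ℕ.m≤n⇒m≤1+n M>a ∷ All.map ℕ.m≤n⇒m≤1+n M>) ∷ ↓)))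
                  (+-cong (Σ-map wᵣ (λ ρ → w (replicate (suc (suc r)) (suc a) ++ ρ)) (suc a ∷_) 1#
                            (λ ρ → trans (reflexive (≡.cong w (replicate-++-∷ (suc r) (suc a) ρ))) (sym (*-identityˡ _))) stay)
                          (Σ-returns n a s M r ↓)) ⟩
      u (suc r) * V n (suc (length s)) 1 + (1# * Σ[ (λ ρ → w (replicate (suc (suc r)) (suc a) ++ ρ)) ] stay + e (suc r) * ΣV n (length s))
        ≈⟨ +-congˡ (+-congʳ (*-congˡ (Σ-walks n a s M (suc r) ↓))) ⟩
      u (suc r) * V n (suc (length s)) 1 + (1# * V n (length s) (suc (suc r)) + e (suc r) * ΣV n (length s))
        ≈⟨ solve 3 (λ p q t → p :+ (:1 :* q :+ t) := q :+ p :+ t) refl _ _ _ ⟩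
      V (suc n) (length s) (suc r) ∎
      where
      wᵣ : List ℕ → Carrier
      wᵣ ρ = w (replicate (suc r) (suc a) ++ ρ)
      up stay : List (List ℕ)
      up   = walks n (M ∷ a ∷ s) (suc M)
      stay = walks n (a ∷ s) M

    Σ-returns n a []      M r ↓ = sym (zeroʳ _)
    Σ-returns n a (b ∷ s) M r ((M>a ∷ M>b ∷ M>) ∷ (a>b ∷ a>) ∷ b∷s↓@(_ ∷ s↓)) = begin
      Σ[ wᵣ ] (map (suc b ∷_) (walks n (b ∷ s) M) ++ returns n s M)
        ≈⟨ Σ-++ wᵣ (map (suc b ∷_) (walks n (b ∷ s) M)) _ ⟩
      Σ[ wᵣ ] (map (suc b ∷_) (walks n (b ∷ s) M)) + Σ[ wᵣ ] (returns n s M)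
        ≈⟨ +-cong (Σ-map wᵣ (w ∘ (suc b ∷_)) (suc b ∷_) (e (suc r)) (λ ρ → run-down r ρ (s<s a>b)) (walks n (b ∷ s) M))
                  (Σ-returns n a s M r ((M>a ∷ M>) ∷ a> ∷ s↓)) ⟩
      e (suc r) * Σ[ w ∘ (suc b ∷_) ] (walks n (b ∷ s) M) + e (suc r) * ΣV n (length s)
        ≈⟨ +-congʳ (*-congˡ (Σ-walks n b s M 0 ((M>b ∷ M>) ∷ b∷s↓))) ⟩
      e (suc r) * V n (length s) 1 + e (suc r) * ΣV n (length s)
        ≈⟨ distribˡ _ _ _ ⟨
      e (suc r) * ΣV n (suc (length s)) ∎
      where
      wᵣ : List ℕ → Carrier
      wᵣ ρ = w (replicate (suc r) (suc a) ++ ρ)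

    Σ-walks≈F : ∀ n → Σ[ w ] (walks n [] 0) ≈ F n
    Σ-walks≈F zero    = trans (+-identityʳ _) start
    Σ-walks≈F (suc n) = begin
      Σ[ w ] (map (1 ∷_) (walks n (0 ∷ []) 1) ++ [])
        ≈⟨ Σ-++ w (map (1 ∷_) (walks n (0 ∷ []) 1)) [] ⟩
      Σ[ w ] (map (1 ∷_) (walks n (0 ∷ []) 1)) + 0#
        ≈⟨ +-identityʳ _ ⟩
      Σ[ w ] (map (1 ∷_) (walks n (0 ∷ []) 1))
        ≈⟨ Σ-map w (w ∘ (1 ∷_)) (1 ∷_) 1# (λ _ → sym (*-identityˡ _)) (walks n (0 ∷ []) 1) ⟩
      1# * Σ[ w ∘ (1 ∷_) ] (walks n (0 ∷ []) 1)
        ≈⟨ *-identityˡ _ ⟩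
      Σ[ w ∘ (1 ∷_) ] (walks n (0 ∷ []) 1)
        ≈⟨ Σ-walks n 0 [] 1 0 ((z<s ∷ []) ∷ [] ∷ []) ⟩
      V n 0 1 ∎

  V[_,_] : ℕ → ℕ → Series
  V[ d , r ] n = V n d r

  T : ℕ → Series
  T r = V[ 0 , r ]

  -- A walk above d + 1 open blocks is, until it returns to the lowest of them, a
  -- walk above d open blocks, and from then on it is counted by F.
  V-factor  : ∀ n d r → V n (suc d) r ≈ (V[ d , r ] S.* F) n
  ΣV-factor : ∀ n d → ΣV n (suc d) ≈ ((λ i → ΣV i d) S.* F) n + V n 0 1

  V-factor zero    d r = solve 1 (λ a → a := a :* :1 :+ :0) refl _
  V-factor (suc n) d r = begin
    V n (suc d) (suc r) + u r * V n (suc (suc d)) 1 + e r * ΣV n (suc d)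
      ≈⟨ +-cong (+-cong (V-factor n d (suc r)) (*-congˡ (V-factor n (suc d) 1))) (*-congˡ (ΣV-factor n d)) ⟩
    (V[ d , suc r ] S.* F) n + u r * (V[ suc d , 1 ] S.* F) n + e r * (((λ i → ΣV i d) S.* F) n + V n 0 1)
      -- The summand `e r * V n 0 1` belongs to walks that return to the lowest block at once. As
      -- `F (suc n)` is `V n 0 1`, it is the index 0 term of the convolution.
      ≈⟨ solve 6 (λ a b c d e f → a :+ b :* c :+ d :* (e :+ f) := d :* f :+ (a :+ b :* c :+ d :* e)) refl
           ((V[ d , suc r ] S.* F) n) (u r) ((V[ suc d , 1 ] S.* F) n) (e r) (((λ i → ΣV i d) S.* F) n) (V n 0 1) ⟩
    e r * V n 0 1 + ((V[ d , suc r ] S.* F) n + u r * (V[ suc d , 1 ] S.* F) n + e r * ((λ i → ΣV i d) S.* F) n)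
      ≈⟨ +-congˡ (+-cong (+-congˡ (S.*-scaleˡ (u r) V[ suc d , 1 ] F n)) (S.*-scaleˡ (e r) (λ i → ΣV i d) F n)) ⟨
    e r * V n 0 1 + ((V[ d , suc r ] S.* F) n + ((λ i → u r * V[ suc d , 1 ] i) S.* F) n + ((λ i → e r * ΣV i d) S.* F) n)
      ≈⟨ +-congˡ (+-congʳ (S.*-distribʳ-+ F V[ d , suc r ] (λ i → u r * V[ suc d , 1 ] i) n)) ⟨
    e r * V n 0 1 + (((V[ d , suc r ] S.+ (λ i → u r * V[ suc d , 1 ] i)) S.* F) n + ((λ i → e r * ΣV i d) S.* F) n)
      ≈⟨ +-congˡ (S.*-distribʳ-+ F (V[ d , suc r ] S.+ (λ i → u r * V[ suc d , 1 ] i)) (λ i → e r * ΣV i d) n) ⟨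
    (V[ d , r ] S.* F) (suc n) ∎

  ΣV-factor n zero    = begin
    V n 0 1 + 0#                    ≈⟨ +-comm _ _ ⟩
    0# + V n 0 1                    ≈⟨ +-congʳ (S.*-zeroˡ F (λ _ → refl) n) ⟨
    ((λ _ → 0#) S.* F) n + V n 0 1  ∎
  ΣV-factor n (suc d) = begin
    V n (suc d) 1 + ΣV n (suc d)
      ≈⟨ +-cong (V-factor n d 1) (ΣV-factor n d) ⟩
    (V[ d , 1 ] S.* F) n + (((λ i → ΣV i d) S.* F) n + V n 0 1)
      ≈⟨ +-assoc _ _ _ ⟨
    (V[ d , 1 ] S.* F) n + ((λ i → ΣV i d) S.* F) n + V n 0 1
      ≈⟨ +-congʳ (S.*-distribʳ-+ F V[ d , 1 ] (λ i → ΣV i d) n) ⟨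
    ((λ i → ΣV i (suc d)) S.* F) n + V n 0 1 ∎

  F-equation : F S.≈ S.1# S.+ x S.* T 1
  F-equation zero    = sym (trans (+-congˡ (S.x*f-zero (T 1))) (+-identityʳ _))
  F-equation (suc n) = sym (trans (+-congˡ (S.x*f-suc (T 1) n)) (+-identityˡ _))

  -- With no block below the top there is nothing to return to, and `V-factor` turns the walks that
  -- open a second block into `T 1 * F`.
  T-equation : ∀ r {a b} → e r ≈ a → u r ≈ b →
    T r S.≈ const a S.+ x S.* (T (suc r) S.+ const b S.* (T 1 S.* F))
  T-equation r {a} {b} e≈a u≈b zero    = begin
    e r            ≈⟨ e≈a ⟩
    a              ≈⟨ +-identityʳ a ⟨
    a + 0#         ≈⟨ +-congˡ (S.x*f-zero (T (suc r) S.+ const b S.* (T 1 S.* F))) ⟨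
    (const a S.+ x S.* (T (suc r) S.+ const b S.* (T 1 S.* F))) 0 ∎
  T-equation r {a} {b} e≈a u≈b (suc n) = begin
    V n 0 (suc r) + u r * V n 1 1 + e r * 0#
      ≈⟨ solve 3 (λ a b c → a :+ b :+ c :* :0 := :0 :+ (a :+ b)) refl _ _ _ ⟩
    0# + (V n 0 (suc r) + u r * V n 1 1)
      ≈⟨ +-congˡ (+-congˡ (*-cong u≈b (V-factor n 0 1))) ⟩
    0# + (V n 0 (suc r) + b * (T 1 S.* F) n)
      ≈⟨ +-congˡ (+-congˡ (S.const-* b (T 1 S.* F) n)) ⟨
    0# + (V n 0 (suc r) + (const b S.* (T 1 S.* F)) n)
      ≈⟨ +-congˡ (S.x*f-suc (T (suc r) S.+ const b S.* (T 1 S.* F)) n) ⟨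
    (const a S.+ x S.* (T (suc r) S.+ const b S.* (T 1 S.* F))) (suc n) ∎

  module _ {k : ℕ} (α : Carrier)
    (e-geometric : ∀ r → k < r → e (suc r) ≈ α * e r)
    (u-geometric : ∀ r → k < r → u (suc r) ≈ α * u r) where

    -- The current run enters the recursion linearly through `e r` and `u r`, or goes on as a run of
    -- length `suc r`, so the common ratio of `e` and `u` beyond `k` passes to `V`.
    V-geometric : ∀ n d r → k < r → V n d (suc r) ≈ α * V n d r
    V-geometric zero    d r k<r = e-geometric r k<r
    V-geometric (suc n) d r k<r = begin
      V n d (suc (suc r)) + u (suc r) * V n (suc d) 1 + e (suc r) * ΣV n d
        ≈⟨ +-cong (+-cong (V-geometric n d (suc r) (ℕ.m≤n⇒m≤1+n k<r)) (*-congʳ (u-geometric r k<r))) (*-congʳ (e-geometric r k<r)) ⟩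
      α * V n d (suc r) + α * u r * V n (suc d) 1 + α * e r * ΣV n d
        ≈⟨ solve 6 (λ a b c d e f → a :* b :+ a :* c :* d :+ a :* e :* f := a :* (b :+ c :* d :+ e :* f)) refl α _ _ _ _ _ ⟩
      α * V (suc n) d r ∎

    T-geometric : ∀ r → k < r → T (suc r) S.≈ const α S.* T r
    T-geometric r k<r n = trans (V-geometric n 0 r k<r) (sym (S.const-* α (T r) n))

-- Elimination to a quadratic equation for F

module Elimination {c ℓ} (S : CommutativeRing c ℓ) where
  open CommutativeRing S
  open IntegerSolver S
  open ≈-Reasoning setoid
  open import Algebra.Definitions.RawSemiring (RawRing.rawSemiring rawRing) using (_^_) renaming (_×_ to _·_)
  open import Algebra.Properties.Group +-group using (x≈y⇒x∙y⁻¹≈ε)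

  -- Lets the solver do the elimination: the left side of the quadratic equation is rewritten as a
  -- combination of the differences of three known equations.
  residuals-vanish : ∀ {a a′ b b′ d d′} u v w → a ≈ a′ → b ≈ b′ → d ≈ d′ →
    u * (a - a′) + v * (b - b′) + w * (d - d′) ≈ 0#
  residuals-vanish u v w a≈ b≈ d≈ = trans
    (+-cong (+-cong (*-congˡ (x≈y⇒x∙y⁻¹≈ε a≈)) (*-congˡ (x≈y⇒x∙y⁻¹≈ε b≈))) (*-congˡ (x≈y⇒x∙y⁻¹≈ε d≈)))
    (solve 3 (λ u v w → u :* :0 :+ v :* :0 :+ w :* :0 := :0) refl u v w)

  2x*≈x* : ∀ x a → 2 · x * a ≈ x * (a + a)
  2x*≈x* = solve 2 (λ x a → (x :+ (x :+ :0)) :* a := x :* (a :+ a)) refl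

  +-*-vanish : ∀ a b {d} → d ≈ 0# → a + b * d ≈ a
  +-*-vanish a b d≈0 = trans (+-congˡ (trans (*-congˡ d≈0) (zeroʳ b))) (+-identityʳ a)

  -- T r is the generating function of the continuations of a run of length r, and
  -- the runs of length at most k do not contain an occurrence.
  module System (x q F : Carrier) (T : ℕ → Carrier) (k : ℕ)
    (F≈      : F ≈ 1# + x * T 1)
    (T-short : ∀ r → r ≤ k → T r ≈ 1# + x * (T (suc r) + 1# * (T 1 * F)))
    where

    -- Iterates `T r ≈ (1 + x T₁ F) + x T (r + 1)`. Multiplying by `1 - x` replaces the geometric
    -- sum 1 + x + ⋯ + x^(j-1) by `1# - x ^ j`.
    short-runs : ∀ j → j ≤ k →
      (1# - x) * T 1 ≈ (1# - x ^ j) * (1# + x * (T 1 * F)) + (1# - x) * (x ^ j * T (suc j))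
    short-runs zero    _   = solve 3 (λ x t f →
      (:1 :- x) :* t := (:1 :- :1) :* (:1 :+ x :* (t :* f)) :+ (:1 :- x) :* (:1 :* t)) refl x (T 1) F
    short-runs (suc j) j<k = begin
      (1# - x) * T 1
        ≈⟨ short-runs j (ℕ.<⇒≤ j<k) ⟩
      (1# - x ^ j) * (1# + x * (T 1 * F)) + (1# - x) * (x ^ j * T (suc j))
        ≈⟨ +-congˡ (*-congˡ (*-congˡ (T-short (suc j) j<k))) ⟩
      (1# - x ^ j) * (1# + x * (T 1 * F)) + (1# - x) * (x ^ j * (1# + x * (T (suc (suc j)) + 1# * (T 1 * F))))
        ≈⟨ solve 5 (λ x X t f t′ →
             (:1 :- X) :* (:1 :+ x :* (t :* f)) :+ (:1 :- x) :* (X :* (:1 :+ x :* (t′ :+ :1 :* (t :* f)))) :=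
             (:1 :- x :* X) :* (:1 :+ x :* (t :* f)) :+ (:1 :- x) :* (x :* X :* t′))
             refl x (x ^ j) (T 1) F (T (suc (suc j))) ⟩
      (1# - x ^ suc j) * (1# + x * (T 1 * F)) + (1# - x) * (x ^ suc j * T (suc (suc j))) ∎

    private
      X t U : Carrier
      X = x ^ k
      t = T 1
      U = T (suc k)

    module Constant
      (T-long : U ≈ q + x * (T (suc (suc k)) + q * (t * F)))
      (T-next : T (suc (suc k)) ≈ q * U)
      where
      A B D s : Carrier
      A = 1# - q * x + (q - 1#) * x ^ suc k
      B = 1# - q * x + (q - 1#) * x ^ k
      D = 2 · x * B
      s = A - D * F

      -- The constant term of `B` depends on `k`: for `k = 0` the power `x ^ k` is 1 and the
      -- constant term is `q`, otherwise it is 1.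
      B≈c+x* : ∃[ c ] ∃[ f ] (c ≡ q ⊎ c ≡ 1#) × B ≈ c + x * f
      B≈c+x* = go k
        where
        go : ∀ k → ∃[ c ] ∃[ f ] (c ≡ q ⊎ c ≡ 1#) × 1# - q * x + (q - 1#) * x ^ k ≈ c + x * f
        go zero    = q , _ , inj₁ ≡.refl ,
          solve 2 (λ x q → :1 :- q :* x :+ (q :- :1) :* :1 := q :+ x :* (:- q)) refl x q
        go (suc k) = 1# , _ , inj₂ ≡.refl ,
          solve 3 (λ x q X → :1 :- q :* x :+ (q :- :1) :* (x :* X) := :1 :+ x :* ((q :- :1) :* X :- q)) refl x q (x ^ k)

      U≈ : U ≈ q + x * (q * U + q * (t * F))
      U≈ = trans T-long (+-congˡ (*-congˡ (+-congʳ T-next)))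

      -- A − x B = (1 − x)(1 − q x), and the three equations are combined so that
      -- neither 1 − x nor 1 − q x has to be cancelled.
      quadratic : x * B * (F * F) - A * F + A ≈ 0#
      quadratic = begin
        x * B * (F * F) - A * F + A
          ≈⟨ solve 6 (λ x q X F t U →
               let a = :1 :- q :* x :+ (q :- :1) :* (x :* X)
                   b = :1 :- q :* x :+ (q :- :1) :* X
               in x :* b :* (F :* F) :- a :* F :+ a :=
                  (x :* b :* F :- (:1 :- x) :* (:1 :- q :* x)) :* (F :- (:1 :+ x :* t))
                  :+ (:- (x :* (:1 :- q :* x))) :* ((:1 :- x) :* t :- ((:1 :- X) :* (:1 :+ x :* (t :* F)) :+ (:1 :- x) :* (X :* U)))
                  :+ (:- (x :* (:1 :- x) :* X)) :* (U :- (q :+ x :* (q :* U :+ q :* (t :* F)))))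
               refl x q X F t U ⟩
        _ ≈⟨ residuals-vanish _ _ _ F≈ (short-runs k ℕ.≤-refl) U≈ ⟩
        0# ∎

      -- Completing the square gives A(A - 4xB) plus 4xB times the left side of `quadratic`, and A -
      -- 4xB is the second factor of the radicand.
      s*s≈ : s * s ≈ A * ((1# - 4 · x) * (1# - q * x) - 3 · ((q - 1#) * x ^ suc k))
      s*s≈ = begin
        s * s
          ≈⟨ solve 4 (λ x q X F →
               let p = q :- :1
                   a = :1 :- q :* x :+ p :* (x :* X)
                   b = :1 :- q :* x :+ p :* X
                   d = (x :+ (x :+ :0)) :* b
                   y = p :* (x :* X)
               in (a :- d :* F) :* (a :- d :* F) :=
                  a :* ((:1 :- (x :+ (x :+ (x :+ (x :+ :0))))) :* (:1 :- q :* x) :- (y :+ (y :+ (y :+ :0))))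
                  :+ con (ℤ.+ 4) :* (x :* b) :* (x :* b :* (F :* F) :- a :* F :+ a))
               refl x q X F ⟩
        _ ≈⟨ +-*-vanish _ _ quadratic ⟩
        A * ((1# - 4 · x) * (1# - q * x) - 3 · ((q - 1#) * x ^ suc k)) ∎

      s≈1+x* : s ≈ 1# + x * ((q - 1#) * X - q - 2 · (B * F))
      s≈1+x* = solve 4 (λ x q X F →
        let b = :1 :- q :* x :+ (q :- :1) :* X; y = b :* F
        in :1 :- q :* x :+ (q :- :1) :* (x :* X) :- (x :+ (x :+ :0)) :* b :* F :=
           :1 :+ x :* ((q :- :1) :* X :- q :- (y :+ (y :+ :0)))) refl x q X F

      D*F≈A-s : D * F ≈ A - s
      D*F≈A-s = solve 2 (λ a y → y := a :- (a :- y)) refl A (D * F)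

    module Ascending
      (T-long : U ≈ 1# + x * (T (suc (suc k)) + q * (t * F)))
      (T-next : T (suc (suc k)) ≈ 1# * U)
      where
      A B D s : Carrier
      A = 1# + (q - 1#) * x ^ suc k
      B = 1# + (q - 1#) * x ^ k
      D = 2 · x * B
      s = A - D * F

      B≈c+x* : ∃[ c ] ∃[ f ] (c ≡ q ⊎ c ≡ 1#) × B ≈ c + x * f
      B≈c+x* = go k
        where
        go : ∀ k → ∃[ c ] ∃[ f ] (c ≡ q ⊎ c ≡ 1#) × 1# + (q - 1#) * x ^ k ≈ c + x * f
        go zero    = q , _ , inj₁ ≡.refl ,
          solve 2 (λ x q → :1 :+ (q :- :1) :* :1 := q :+ x :* :0) refl x q
        go (suc k) = 1# , _ , inj₂ ≡.refl ,
          solve 3 (λ x q X → :1 :+ (q :- :1) :* (x :* X) := :1 :+ x :* ((q :- :1) :* X)) refl x q (x ^ k)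

      U≈ : U ≈ 1# + x * (1# * U + q * (t * F))
      U≈ = trans T-long (+-congˡ (*-congˡ (+-congʳ T-next)))

      -- Here A - xB = 1 - x. Moreover `U≈` is an equation for (1 - x)U, the multiple of `U` that
      -- `short-runs` contains, so the cofactors `- x` and `- (x * X)` already remove `U`.
      quadratic : x * B * (F * F) - A * F + 1# ≈ 0#
      quadratic = begin
        x * B * (F * F) - A * F + 1#
          ≈⟨ solve 6 (λ x q X F t U →
               let a = :1 :+ (q :- :1) :* (x :* X)
                   b = :1 :+ (q :- :1) :* X
               in x :* b :* (F :* F) :- a :* F :+ :1 :=
                  (x :* b :* F :- (:1 :- x)) :* (F :- (:1 :+ x :* t))
                  :+ (:- x) :* ((:1 :- x) :* t :- ((:1 :- X) :* (:1 :+ x :* (t :* F)) :+ (:1 :- x) :* (X :* U)))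
                  :+ (:- (x :* X)) :* (U :- (:1 :+ x :* (:1 :* U :+ q :* (t :* F)))))
               refl x q X F t U ⟩
        _ ≈⟨ residuals-vanish _ _ _ F≈ (short-runs k ℕ.≤-refl) U≈ ⟩
        0# ∎

      -- The discriminant is A² - 4xB. Its part 4(q-1)x^(k+1) coming from 4xB turns the square of 1
      -- + (q-1)x^(k+1) into that of 1 - (q-1)x^(k+1).
      s*s≈ : s * s ≈ (1# - (q - 1#) * x ^ suc k) ^ 2 - 4 · x
      s*s≈ = begin
        s * s
          ≈⟨ solve 4 (λ x q X F →
               let p = q :- :1
                   a = :1 :+ p :* (x :* X)
                   b = :1 :+ p :* X
                   d = (x :+ (x :+ :0)) :* b
                   y = :1 :- p :* (x :* X)
               in (a :- d :* F) :* (a :- d :* F) :=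
                  (y :* (y :* :1) :- (x :+ (x :+ (x :+ (x :+ :0)))))
                  :+ con (ℤ.+ 4) :* (x :* b) :* (x :* b :* (F :* F) :- a :* F :+ :1))
               refl x q X F ⟩
        _ ≈⟨ +-*-vanish _ _ quadratic ⟩
        (1# - (q - 1#) * x ^ suc k) ^ 2 - 4 · x ∎

      s≈1+x* : s ≈ 1# + x * ((q - 1#) * X - 2 · (B * F))
      s≈1+x* = solve 4 (λ x q X F →
        let b = :1 :+ (q :- :1) :* X; y = b :* F
        in :1 :+ (q :- :1) :* (x :* X) :- (x :+ (x :+ :0)) :* b :* F :=
           :1 :+ x :* ((q :- :1) :* X :- (y :+ (y :+ :0)))) refl x q X F

      D*F≈A-s : D * F ≈ A - s
      D*F≈A-s = solve 2 (λ a y → y := a :- (a :- y)) refl A (D * F)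

-- The two generating functions

module GeneratingFunctions {c ℓ} (K : CommutativeRing c ℓ) (y : CommutativeRing.Carrier K) where
  private module K = CommutativeRing K
  open import Algebra.Properties.Semiring.Exp K.semiring using (^-homo-*) renaming (_^_ to _^ᴷ_)
  open WeightedSum K using (Σ[_]; Σ-↭)
  open PowerSeries K.rawRing
  open RawRing rawRing
  open import Algebra.Definitions.RawSemiring rawSemiring using (_^_) renaming (_×_ to _·_)
  private
    module S = CommutativeRing (SeriesRing.commutativeRing K)
    module SR = SeriesRing K
    module Elim = Elimination (SeriesRing.commutativeRing K)
  open S using (_-_)
  open ≈-Reasoning K.setoid

  q : Series
  q = const y

  weight : List ℕ → List ℕ → K.Carrier
  weight τ ρ = y ^ᴷ μ τ ρ

  genFun : List ℕ → Series
  genFun τ n = Σ[ weight τ ] (NC n)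

  weight-+ : ∀ τ {ρ} a {ρ′} → μ τ ρ ≡ a ℕ.+ μ τ ρ′ → weight τ ρ K.≈ y ^ᴷ a K.* weight τ ρ′
  weight-+ τ a {ρ′} eq = K.trans (K.reflexive (≡.cong (y ^ᴷ_) eq)) (^-homo-* y a (μ τ ρ′))

  weight-≡ : ∀ τ {ρ} a → μ τ ρ ≡ a → weight τ ρ K.≈ y ^ᴷ a
  weight-≡ τ a eq = K.reflexive (≡.cong (y ^ᴷ_) eq)

  constant-term : ∀ f a g → f ≈ a + x * g → f 0 K.≈ a 0
  constant-term f a g f≈ =
    K.trans (f≈ 0) (K.trans (K.+-congˡ (SR.x*f-zero g)) (K.+-identityʳ _))

  module NonZero (2≉0 : ¬ K.1# K.+ K.1# K.≈ K.0#) (2y≉0 : ¬ y K.+ y K.≈ K.0#) where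
    -- The coefficient of x in 2xB is twice the constant term of `B`.
    2x*≉0 : ∀ B → (∃[ c ] ∃[ f ] (c ≡ q ⊎ c ≡ 1#) × B ≈ c + x * f) →
      2 · x * B ≉ 0#
    2x*≉0 B (c , f , c≡ , B≈) 2xB≈0 = absurd c≡ (begin
      c 0 K.+ c 0          ≈⟨ K.+-cong (constant-term B c f B≈) (constant-term B c f B≈) ⟨
      B 0 K.+ B 0          ≈⟨ SR.x*f-suc (B + B) 0 ⟨
      (x * (B + B)) 1      ≈⟨ Elim.2x*≈x* x B 1 ⟨
      (2 · x * B) 1        ≈⟨ 2xB≈0 1 ⟩
      K.0#                 ∎)
      where
      absurd : ∀ {c} → (c ≡ q ⊎ c ≡ 1#) → ¬ c 0 K.+ c 0 K.≈ K.0#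
      absurd (inj₁ ≡.refl) = 2y≉0
      absurd (inj₂ ≡.refl) = 2≉0

    -- A run of length `r` contains `r ∸ k` occurrences whatever follows it, so one function serves
    -- for both kinds of run end, with ratio `y` beyond `k`.
    constant : ∀ k →
      ∃[ s ] s IsSqrtOf
               ((1# - q * x + (q - 1#) * x ^ suc k) *
                ((1# - 4 · x) * (1# - q * x) - 3 · ((q - 1#) * x ^ suc k)))
           × genFun (1^ suc k) IsQuotientOf
               (1# - q * x + (q - 1#) * x ^ suc k - s)
               By (2 · x * (1# - q * x + (q - 1#) * x ^ k))
    constant k = Q.s , (Q.s*s≈ , constant-term Q.s 1# _ Q.s≈1+x*) ,
      2x*≉0 Q.B Q.B≈c+x*  ,
      S.trans {Q.D * genFun τ} {Q.D * F} (SR.*-cong {Q.D} (λ _ → K.refl) genFun≈F) Q.D*F≈A-s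
      where
      τ : List ℕ
      τ = 1^ suc k

      e : ℕ → K.Carrier
      e r = y ^ᴷ (r ∸ k)

      open Transfer K e e

      genFun≈F : genFun τ ≈ F
      genFun≈F n = K.trans (Σ-↭ (weight τ) (NC↭walks n)) $ Σ-walks≈F (weight τ)
        (weight-≡ τ 0 (μ-[] 1 (1^ k)))
        (λ a r → weight-≡ τ (suc r ∸ k) $ ≡.trans (μ-1^ k (suc r) []) $
          ≡.trans (≡.cong (suc r ∸ k ℕ.+_) (μ-[] 1 (1^ k))) (ℕ.+-identityʳ _))
        (λ r σ a<b → weight-+ τ (suc r ∸ k) (μ-1^ k (suc r) (ℕ.<⇒≢ a<b ∷ σ)))
        (λ r σ b<a → weight-+ τ (suc r ∸ k) (μ-1^ k (suc r) (ℕ.>⇒≢ b<a ∷ σ)))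
        n

      e-short : ∀ r → r ≤ k → e r K.≈ K.1#
      e-short r r≤k = K.reflexive (≡.cong (y ^ᴷ_) (ℕ.m≤n⇒m∸n≡0 r≤k))

      e-geometric : ∀ r → k < r → e (suc r) K.≈ y K.* e r
      e-geometric r k<r = K.reflexive (≡.cong (y ^ᴷ_) (ℕ.+-∸-assoc 1 (ℕ.<⇒≤ k<r)))

      e-first : e (suc k) K.≈ y
      e-first = K.trans (K.reflexive (≡.cong (y ^ᴷ_) (ℕ.m+n∸n≡m 1 k))) (K.*-identityʳ y)

      module L = Elim.System x q F T k F-equation
        (λ r r≤k → T-equation r (e-short r r≤k) (e-short r r≤k))
      module Q = L.Constant (T-equation (suc k) e-first e-first)
        (T-geometric y e-geometric e-geometric (suc k) ℕ.≤-refl)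

    -- Only an ascent out of a run of length at least `k + 1` produces an occurrence, and then
    -- exactly one. So `e` is 1 and `u` is constant beyond `k`: the ratio is 1.
    ascending : ∀ k →
      ∃[ s ] s IsSqrtOf
               ((1# - (q - 1#) * x ^ suc k) ^ 2 - 4 · x)
           × genFun (1^ suc k ++ [ 2 ]) IsQuotientOf
               (1# + (q - 1#) * x ^ suc k - s)
               By (2 · x * (1# + (q - 1#) * x ^ k))
    ascending k = Q.s , (Q.s*s≈ , constant-term Q.s 1# _ Q.s≈1+x*) ,
      2x*≉0 Q.B Q.B≈c+x*  ,
      S.trans {Q.D * genFun τ} {Q.D * F} (SR.*-cong {Q.D} (λ _ → K.refl) genFun≈F) Q.D*F≈A-s
      where
      τ : List ℕ
      τ = 1^ suc k ++ [ 2 ]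

      e u : ℕ → K.Carrier
      e r = K.1#
      u r = y ^ᴷ ((r ∸ k) ⊓ 1)

      open Transfer K e u

      genFun≈F : genFun τ ≈ F
      genFun≈F n = K.trans (Σ-↭ (weight τ) (NC↭walks n)) $ Σ-walks≈F (weight τ)
        (weight-≡ τ 0 (μ-[] 1 (1^ k ++ [ 2 ])))
        (λ a r → weight-≡ τ 0 (≡.trans (μ-1^2-down k (suc r) []) (μ-[] 1 (1^ k ++ [ 2 ]))))
        (λ r σ a<b → weight-+ τ ((suc r ∸ k) ⊓ 1) (μ-1^2-up k (suc r) σ a<b))
        (λ r σ b<a → weight-+ τ 0 (μ-1^2-down k (suc r) (b<a ∷ σ)))
        n

      u-short : ∀ r → r ≤ k → u r K.≈ K.1#
      u-short r r≤k = K.reflexive (≡.cong (λ n → y ^ᴷ (n ⊓ 1)) (ℕ.m≤n⇒m∸n≡0 r≤k))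

      u-long : ∀ r → k < r → u r K.≈ y
      u-long r k<r = K.trans (K.reflexive (≡.cong (y ^ᴷ_) (ℕ.m≥n⇒m⊓n≡n (ℕ.m<n⇒0<n∸m k<r)))) (K.*-identityʳ y)

      u-geometric : ∀ r → k < r → u (suc r) K.≈ K.1# K.* u r
      u-geometric r k<r = K.trans (u-long (suc r) (ℕ.m≤n⇒m≤1+n k<r)) (K.trans (K.sym (u-long r k<r)) (K.sym (K.*-identityˡ _)))

      module L = Elim.System x q F T k F-equation
        (λ r r≤k → T-equation r K.refl (u-short r r≤k))
      module Q = L.Ascending (T-equation (suc k) K.refl (u-long (suc k) ℕ.≤-refl))
        (T-geometric K.1# (λ _ _ → K.sym (K.*-identityˡ _)) u-geometric (suc k) ℕ.≤-refl)

module ℚ⟨q⟩⟦x⟧Solution = GeneratingFunctions FractionField.commutativeRing Fraction.q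

2≉0 : let open RawRing Fraction.rawRing in ¬ 1# + 1# ≈ 0#
2≉0 2≈0 with () ← 2≈0 0

2q≉0 : let open RawRing Fraction.rawRing in ¬ Fraction.q + Fraction.q ≈ 0#
2q≉0 2q≈0 with () ← 2q≈0 1

corollary2 : (m : ℕ) → 1 ≤ m → let open ℚ⟨q⟩⟦x⟧ in
  (∃[ s ] s IsSqrtOf
            ((1# - q * x + (q - 1#) * x ^ m) *
             ((1# - 4 · x) * (1# - q * x) - 3 · ((q - 1#) * x ^ m)))
        × genFun (1^ m) IsQuotientOf
            (1# - q * x + (q - 1#) * x ^ m - s)
            By (2 · x * (1# - q * x + (q - 1#) * x ^ (m ∸ 1))))
  ×
  (∃[ s ] s IsSqrtOf
            ((1# - (q - 1#) * x ^ m) ^ 2 - 4 · x)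
        × genFun (1^ m ++ [ 2 ]) IsQuotientOf
            (1# + (q - 1#) * x ^ m - s)
            By (2 · x * (1# + (q - 1#) * x ^ (m ∸ 1))))
-- For `m = suc k` the exponent `m ∸ 1` reduces to `k`, and over ℚ(q) the generic `genFun` unfolds
-- to that of the statement.
corollary2 (suc k) _ = constant 2≉0 2q≉0 k , ascending 2≉0 2q≉0 k
  where open ℚ⟨q⟩⟦x⟧Solution.NonZero
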